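{- The first-order theory $\mathrm{ECDA}$ is the model completion of the theory of De Morgan algebras. Moreover, $\mathrm{ECDA}$ is complete and admits elimination of quantifiers (in the language $\{+,\cdot,\bar{\ },0,1\}$ of De Morgan algebras).
   Context: A De Morgan algebra is a structure $(D;+,\cdot,\bar{\ },0,1)$ where $(D;+,\cdot,0,1)$ is a bounded distributive lattice ($+$ is join, $\cdot$ is meet, $0$ smallest, $1$ largest element) and $\bar{\ }$ is a unary operation with $\bar{\bar x}=x$ and $\overline{x+y}=\bar x\cdot\bar y$ for all $x,y$. Convention: $0\neq 1$. It is complemented if $\forall x\exists y\,(xy=0\wedge x+y=1)$. Model completion: a theory $T'$ is a model companion of $T$ if $T'$ is model complete (every formula is equivalent modulo $T'$ to an existential one), every model of $T$ embeds into a model of $T'$, and every model of $T'$ embeds into a model of $T$. If $T$ has the amalgamation property (for models $M_0,M_1,M_2$ of $T$ and embeddings $f_i:M_0\to M_i$, $i=1,2$, there are a model $M$ of $T$ and embeddings $g_i:M_i\to M$ with $g_1f_1=g_2f_2$), a model companion of $T$ is called its model completion. Consistency: for $\sigma\in S_n$, a triple $(I_1,I_2,I_3)$ of subsets of $\{1,\dots,n\}$ is $\sigma$-consistent if $\sigma(I_2)=I_2$, $\sigma(I_3)=I_3$, and $(I_1\cap I_2\cap I_3)\cap\sigma(I_1\cap I_2\cap I_3)=\emptyset$. Formulas: for $y=(y_1,\dots,y_n)$ and $I\subseteq\{1,\dots,n\}$ put $$\tilde\psi^n_I(y,x):=\bigwedge_{i\in I}y_i\cdot x\bar x=0\wedge\bigwedge_{i\notin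 I}y_i\cdot x\bar x\neq0,$$ $$\tilde\xi^n_I(y,x):=\exists z\Big(\bar x+z=1\wedge\bar xz=0\wedge\bigwedge_{i\in I}y_i\cdot xz=0\wedge\bigwedge_{i\notin I}y_i\cdot xz\neq0\Big),$$ $$\tilde\chi^n_I(y,x):=\exists z\Big(x+z=1\wedge xz=0\wedge\bigwedge_{i\in I}y_i\cdot z\bar x=0\wedge\bigwedge_{i\notin I}y_i\cdot z\bar x\neq0\Big),$$ and $\tilde\varphi^n_{(I_1,I_2,I_3)}(y,x):=\tilde\psi^n_{I_1}(y,x)\wedge\tilde\xi^n_{I_2}(y,x)\wedge\tilde\chi^n_{I_3}(y,x)$. The theory $\mathrm{ECDA}$ consists of the axioms of complemented De Morgan algebras and the sentences $$\forall y_1,\dots,y_n\Big(\bigwedge_iy_i\neq0\wedge\sum_{i=1}^ny_i=1\wedge\bigwedge_{i\neq j}y_iy_j=0\wedge\bigwedge_i(\bar y_i+y_{\sigma(i)}=1\wedge\bar y_iy_{\sigma(i)}=0)\rightarrow\exists x\,\tilde\varphi^n_{(I_1,I_2,I_3)}(y,x)\Big)$$ for each integer $n\ge1$, each $\sigma\in S_n$ with $\sigma^2$ the identity, and each $\sigma$-consistent triple $(I_1,I_2,I_3)$ of subsets of $\{1,\dots,n\}$. -}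

module Defs where

open import Algebra.Core using (Op₁; Op₂)
open import Algebra.Morphism.Definitions using (Homomorphic₀; Homomorphic₁; Homomorphic₂)
open import Data.Bool.Base using (if_then_else_)
open import Data.Empty.Polymorphic using (⊥)
open import Data.Fin.Base using (Fin; zero; suc)
open import Data.Fin.Permutation using (Permutation′; _⟨$⟩ʳ_; _⟨$⟩ˡ_)
open import Data.Fin.Properties using (_≟_)
open import Data.Fin.Subset using (Subset; ∁; _∩_; Empty)
open import Data.Nat.Base using (ℕ; zero; suc; 2+; _≤_)
open import Data.Product.Base using (_×_; Σ-syntax; ∃-syntax)
open import Data.Sum.Base using (_⊎_)
open import Data.Vec.Base using (Vec; []; _∷_; lookup; tabulate)
open import Data.Vec.Functional using (foldr)
open import Function.Definitions using (Congruent; Injective)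
open import Level using (Level) renaming (suc to lsuc)
open import Relation.Binary.Core using (Rel)
open import Relation.Binary.PropositionalEquality using (_≡_)
open import Relation.Binary.Structures using (IsEquivalence)
open import Relation.Nullary.Decidable.Core using (⌊_⌋)

private
  variable
    n : ℕ

infix  9 _‾
infixl 8 _·_
infixl 7 _+_
infix  6 _≐_ _≠_
infixr 5 _∧_
infixr 4 _∨_
infixr 3 _⇒_
infix  3 _⇔_

-- Variables are de Bruijn indices: the terms and formulas indexed by n
-- have their free variables among n variables, and a quantifier binds
-- variable zero.

data Term (n : ℕ) : Set where
  var     : Fin n → Term n
  _+_ _·_ : Term n → Term n → Term n
  _‾      : Term n → Term n
  𝟎 𝟏     : Term n

data Formula (n : ℕ) : Set where
  _≐_         : Term n → Term n → Formula n
  false       : Formula n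
  _∧_ _∨_ _⇒_ : Formula n → Formula n → Formula n
  all ex      : Formula (suc n) → Formula n

Sentence : Set
Sentence = Formula 0

true : Formula n
true = false ⇒ false

_≠_ : Term n → Term n → Formula n
s ≠ t = s ≐ t ⇒ false

neg : Formula n → Formula n
neg φ = φ ⇒ false

_⇔_ : Formula n → Formula n → Formula n
φ ⇔ ψ = (φ ⇒ ψ) ∧ (ψ ⇒ φ)

closure : Formula n → Sentence
closure {zero}  φ = φ
closure {suc n} φ = closure (all φ)

data QuantifierFree {n : ℕ} : Formula n → Set where
  _≐_   : ∀ s t → QuantifierFree (s ≐ t)
  false : QuantifierFree false
  _∧_   : ∀ {φ ψ} → QuantifierFree φ → QuantifierFree ψ → QuantifierFree (φ ∧ ψ)
  _∨_   : ∀ {φ ψ} → QuantifierFree φ → QuantifierFree ψ → QuantifierFree (φ ∨ ψ)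
  _⇒_   : ∀ {φ ψ} → QuantifierFree φ → QuantifierFree ψ → QuantifierFree (φ ⇒ ψ)

data Existential : {n : ℕ} → Formula n → Set where
  qf : ∀ {n} {φ : Formula n} → QuantifierFree φ → Existential φ
  ex : ∀ {n} {φ : Formula (suc n)} → Existential φ → Existential (ex φ)

Theory : Set₁
Theory = Sentence → Set

-- Equality is interpreted by a congruence _≈_, i.e. a structure is a
-- setoid: there are no quotient types, and the carrier of the structure
-- proper is Carrier modulo _≈_.

record Structure (ℓ : Level) : Set (lsuc ℓ) where
  infix 4 _≈_
  field
    Carrier       : Set ℓ
    _≈_           : Rel Carrier ℓ
    plus times    : Op₂ Carrier
    bar           : Op₁ Carrier
    zeroᴰ oneᴰ    : Carrier
    isEquivalence : IsEquivalence _≈_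
    plus-cong     : ∀ {x x′ y y′} → x ≈ x′ → y ≈ y′ → plus x y ≈ plus x′ y′
    times-cong    : ∀ {x x′ y y′} → x ≈ x′ → y ≈ y′ → times x y ≈ times x′ y′
    bar-cong      : ∀ {x x′} → x ≈ x′ → bar x ≈ bar x′

module _ {ℓ : Level} (M : Structure ℓ) where
  open Structure M

  ⟦_⟧ : Term n → Vec Carrier n → Carrier
  ⟦ var i ⟧ ρ = lookup ρ i
  ⟦ s + t ⟧ ρ = plus (⟦ s ⟧ ρ) (⟦ t ⟧ ρ)
  ⟦ s · t ⟧ ρ = times (⟦ s ⟧ ρ) (⟦ t ⟧ ρ)
  ⟦ t ‾ ⟧   ρ = bar (⟦ t ⟧ ρ)
  ⟦ 𝟎 ⟧     ρ = zeroᴰ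
  ⟦ 𝟏 ⟧     ρ = oneᴰ

  Satisfies : Vec Carrier n → Formula n → Set ℓ
  Satisfies ρ (s ≐ t) = ⟦ s ⟧ ρ ≈ ⟦ t ⟧ ρ
  Satisfies ρ false   = ⊥
  Satisfies ρ (φ ∧ ψ) = Satisfies ρ φ × Satisfies ρ ψ
  Satisfies ρ (φ ∨ ψ) = Satisfies ρ φ ⊎ Satisfies ρ ψ
  Satisfies ρ (φ ⇒ ψ) = Satisfies ρ φ → Satisfies ρ ψ
  Satisfies ρ (all φ) = ∀ a → Satisfies (a ∷ ρ) φ
  Satisfies ρ (ex φ)  = ∃[ a ] Satisfies (a ∷ ρ) φ

  IsModel : Theory → Set ℓ
  IsModel T = ∀ φ → T φ → Satisfies [] φ

-- The language has no relation symbols, so an embedding is an injective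
-- homomorphism.

record Embedding {ℓ : Level} (M N : Structure ℓ) : Set ℓ where
  private
    module M = Structure M
    module N = Structure N
  field
    map        : M.Carrier → N.Carrier
    cong       : Congruent M._≈_ N._≈_ map
    injective  : Injective M._≈_ N._≈_ map
    plus-homo  : Homomorphic₂ M.Carrier N.Carrier N._≈_ map M.plus N.plus
    times-homo : Homomorphic₂ M.Carrier N.Carrier N._≈_ map M.times N.times
    bar-homo   : Homomorphic₁ M.Carrier N.Carrier N._≈_ map M.bar N.bar
    zero-homo  : Homomorphic₀ M.Carrier N.Carrier N._≈_ map M.zeroᴰ N.zeroᴰ
    one-homo   : Homomorphic₀ M.Carrier N.Carrier N._≈_ map M.oneᴰ N.oneᴰ

-- Models range over structures in a fixed universe ℓ.
module _ (ℓ : Level) where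

  -- ρ is universally quantified: for φ with free variables this is T ⊨ closure φ.
  Entails : Theory → Formula n → Set (lsuc ℓ)
  Entails T φ = (M : Structure ℓ) → IsModel M T → ∀ ρ → Satisfies M ρ φ

  ModelComplete : Theory → Set (lsuc ℓ)
  ModelComplete T = ∀ {n} (φ : Formula n) →
    ∃[ ψ ] Existential ψ × Entails T (φ ⇔ ψ)

  QuantifierElimination : Theory → Set (lsuc ℓ)
  QuantifierElimination T = ∀ {n} (φ : Formula n) →
    ∃[ ψ ] QuantifierFree ψ × Entails T (φ ⇔ ψ)

  Satisfiable : Theory → Set (lsuc ℓ)
  Satisfiable T = Σ[ M ∈ Structure ℓ ] IsModel M T

  Complete : Theory → Set (lsuc ℓ)
  Complete T = Satisfiable T × ((φ : Sentence) → Entails T φ ⊎ Entails T (neg φ))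

  ModelsEmbedInto : Theory → Theory → Set (lsuc ℓ)
  ModelsEmbedInto T T′ = (M : Structure ℓ) → IsModel M T →
    Σ[ N ∈ Structure ℓ ] IsModel N T′ × Embedding M N

  record IsModelCompanion (T′ T : Theory) : Set (lsuc ℓ) where
    field
      modelComplete : ModelComplete T′
      T-into-T′     : ModelsEmbedInto T T′
      T′-into-T     : ModelsEmbedInto T′ T

  Amalgamation : Theory → Set (lsuc ℓ)
  Amalgamation T = (M₀ M₁ M₂ : Structure ℓ) →
    IsModel M₀ T → IsModel M₁ T → IsModel M₂ T →
    (f₁ : Embedding M₀ M₁) (f₂ : Embedding M₀ M₂) →
    Σ[ M ∈ Structure ℓ ] IsModel M T ×
    Σ[ g₁ ∈ Embedding M₁ M ] Σ[ g₂ ∈ Embedding M₂ M ]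
      (∀ a → Structure._≈_ M (Embedding.map g₁ (Embedding.map f₁ a))
                             (Embedding.map g₂ (Embedding.map f₂ a)))

  record IsModelCompletion (T′ T : Theory) : Set (lsuc ℓ) where
    field
      amalgamation     : Amalgamation T
      isModelCompanion : IsModelCompanion T′ T

private
  x y z : Term 3
  x = var zero
  y = var (suc zero)
  z = var (suc (suc zero))

-- The axioms up to ·-one say that (D; +, ·, 0, 1) is a bounded
-- distributive lattice.

data DeMorgan : Theory where
  +-comm       : DeMorgan (closure (x + y ≐ y + x))
  +-assoc      : DeMorgan (closure ((x + y) + z ≐ x + (y + z)))
  ·-comm       : DeMorgan (closure (x · y ≐ y · x))
  ·-assoc      : DeMorgan (closure ((x · y) · z ≐ x · (y · z)))
  +-absorbs-·  : DeMorgan (closure (x + x · y ≐ x))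
  ·-absorbs-+  : DeMorgan (closure (x · (x + y) ≐ x))
  +-distrib-·  : DeMorgan (closure (x + y · z ≐ (x + y) · (x + z)))
  ·-distrib-+  : DeMorgan (closure (x · (y + z) ≐ x · y + x · z))
  +-zero       : DeMorgan (closure (x + 𝟎 ≐ x))
  ·-one        : DeMorgan (closure (x · 𝟏 ≐ x))
  bar-invol    : DeMorgan (closure ((x ‾) ‾ ≐ x))
  bar-plus     : DeMorgan (closure ((x + y) ‾ ≐ x ‾ · y ‾))
  zero≠one     : DeMorgan (𝟎 ≠ 𝟏)

data ComplementedDeMorgan : Theory where
  deMorgan     : ∀ {φ} → DeMorgan φ → ComplementedDeMorgan φ
  complemented : ComplementedDeMorgan
    (all (ex (let x = var (suc zero); y = var zero in
              x · y ≐ 𝟎 ∧ x + y ≐ 𝟏)))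

⋀ : ∀ {m} → (Fin m → Formula n) → Formula n
⋀ = foldr _∧_ true

∑ : ∀ {m} → (Fin m → Term n) → Term n
∑ = foldr _+_ 𝟎

infix 2 ⋀∈ ⋀∉

⋀∈ ⋀∉ : ∀ {m} → Subset m → (Fin m → Formula n) → Formula n
⋀∈ I φ = ⋀ λ i → if lookup I i then φ i else true
⋀∉ I φ = ⋀∈ (∁ I) φ

syntax ⋀∈ I (λ i → φ) = ⋀[ i ∈ I ] φ
syntax ⋀∉ I (λ i → φ) = ⋀[ i ∉ I ] φ

-- The formulas ψ̃, ξ̃, χ̃, φ̃ have x as variable zero and yᵢ as variable
-- suc i; below the quantifier over z these are shifted by one.

ψ̃ ξ̃ χ̃ : Subset n → Formula (suc n)

ψ̃ {n} I =
  (⋀[ i ∈ I ] y′ i · (x′ · x′ ‾) ≐ 𝟎) ∧ (⋀[ i ∉ I ] y′ i · (x′ · x′ ‾) ≠ 𝟎)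
  where
  x′ : Term (suc n)
  x′ = var zero
  y′ : Fin n → Term (suc n)
  y′ i = var (suc i)

ξ̃ {n} I = ex (x′ ‾ + z′ ≐ 𝟏 ∧ x′ ‾ · z′ ≐ 𝟎 ∧
  (⋀[ i ∈ I ] y′ i · (x′ · z′) ≐ 𝟎) ∧ (⋀[ i ∉ I ] y′ i · (x′ · z′) ≠ 𝟎))
  where
  z′ x′ : Term (2+ n)
  z′ = var zero
  x′ = var (suc zero)
  y′ : Fin n → Term (2+ n)
  y′ i = var (suc (suc i))

χ̃ {n} I = ex (x′ + z′ ≐ 𝟏 ∧ x′ · z′ ≐ 𝟎 ∧
  (⋀[ i ∈ I ] y′ i · (z′ · x′ ‾) ≐ 𝟎) ∧ (⋀[ i ∉ I ] y′ i · (z′ · x′ ‾) ≠ 𝟎))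
  where
  z′ x′ : Term (2+ n)
  z′ = var zero
  x′ = var (suc zero)
  y′ : Fin n → Term (2+ n)
  y′ i = var (suc (suc i))

φ̃ : (I₁ I₂ I₃ : Subset n) → Formula (suc n)
φ̃ I₁ I₂ I₃ = ψ̃ I₁ ∧ ξ̃ I₂ ∧ χ̃ I₃

-- i ∈ σ(I) iff σ⁻¹(i) ∈ I.
image : Permutation′ n → Subset n → Subset n
image σ I = tabulate λ i → lookup I (σ ⟨$⟩ˡ i)

record Consistent (σ : Permutation′ n) (I₁ I₂ I₃ : Subset n) : Set where
  field
    fixes-I₂ : image σ I₂ ≡ I₂
    fixes-I₃ : image σ I₃ ≡ I₃
    disjoint : Empty ((I₁ ∩ I₂ ∩ I₃) ∩ image σ (I₁ ∩ I₂ ∩ I₃))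

extensionAxiom : Permutation′ n → (I₁ I₂ I₃ : Subset n) → Sentence
extensionAxiom {n} σ I₁ I₂ I₃ = closure
  ( (⋀ λ i → y′ i ≠ 𝟎)
  ∧ ∑ y′ ≐ 𝟏
  ∧ (⋀ λ i → ⋀ λ j → if ⌊ i ≟ j ⌋ then true else y′ i · y′ j ≐ 𝟎)
  ∧ (⋀ λ i → y′ i ‾ + y′ (σ ⟨$⟩ʳ i) ≐ 𝟏 ∧ y′ i ‾ · y′ (σ ⟨$⟩ʳ i) ≐ 𝟎)
  ⇒ ex (φ̃ I₁ I₂ I₃))
  where
  y′ : Fin n → Term n
  y′ = var

data ECDA : Theory where
  complementedDeMorgan : ∀ {φ} → ComplementedDeMorgan φ → ECDA φ
  extension : ∀ {n} → 1 ≤ n →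
    (σ : Permutation′ n) → (∀ i → σ ⟨$⟩ʳ (σ ⟨$⟩ʳ i) ≡ i) →
    (I₁ I₂ I₃ : Subset n) → Consistent σ I₁ I₂ I₃ →
    ECDA (extensionAxiom σ I₁ I₂ I₃)

{-# OPTIONS --safe #-}

-- Everything is reduced to the four-element algebra 𝟜 = {0,1}², whose bar is
-- (a , b) ↦ (¬ b , ¬ a).  A prime filter of a De Morgan algebra gives a
-- homomorphism to 𝟜; as choice is not available, prime filters are replaced
-- by pairs u ⋢ w deciding a given finite set of elements, so that an algebra
-- becomes an algebra of 𝟜-valued functions modulo a filter.
--
-- Amalgamation: take the pairs of such points of M₁ and M₂ that agree on
-- finitely many elements of M₀, and all 𝟜-valued functions on them that
-- depend moreover on finitely many coordinates of a point of 𝟜^ℕ.  These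
-- extra coordinates split every nonzero cell, so the amalgam is a model of
-- ECDA; amalgamating M with itself embeds M into such a model.
--
-- Quantifier elimination: the quantifier-free type of an n-tuple is determined
-- by the set of those e in 𝟜ⁿ that are the value of the tuple at some point,
-- and "e is no such value" is an equation.  The extension axioms, applied to
-- the cells of a tuple, are exactly the back-and-forth property for these
-- types.  Completeness is the case of the empty tuple.

module Submission where

open import Defs hiding (true)
open import Axiom.ExcludedMiddle using (ExcludedMiddle)
open import Algebra.Lattice.Bundles using (Lattice)
import Algebra.Lattice.Properties.BooleanAlgebra as BooleanAlgebraProperties
import Algebra.Lattice.Properties.Lattice as LatticeProperties
open import Data.Bool.Base using (Bool; not; if_then_else_; _xor_)
  renaming (true to 1ᵇ; false to 0ᵇ; _∧_ to _∧ᵇ_; _∨_ to _∨ᵇ_)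
import Data.Bool.Properties as Bool
open import Data.Empty using (⊥-elim)
open import Data.Fin.Base using (Fin; zero; suc)
open import Data.Fin.Permutation using (Permutation′; permutation; _⟨$⟩ʳ_; _⟨$⟩ˡ_; inverseˡ)
import Data.Fin.Properties as Fin
open import Data.Fin.Subset using (Subset; _∩_)
open import Data.List.Base as List using (List; []; _∷_; _++_)
open import Data.List.Membership.Propositional using (_∈_)
open import Data.List.Membership.Propositional.Properties using (∈-cartesianProductWith⁺; ∈-allFin)
open import Data.List.Relation.Unary.All as All using (All; []; _∷_)
import Data.List.Relation.Unary.All.Properties as All
open import Data.List.Relation.Unary.Any using (here; there)
open import Data.Nat.Base as ℕ using (ℕ; zero; suc; _≤_; _<_; z≤n; s≤s)
import Data.Nat.Properties as ℕ
open import Data.Product using (_×_; _,_; proj₁; proj₂; Σ-syntax; ∃; ∃-syntax; swap; -,_; uncurry)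
open import Data.Product.Properties using (≡-dec)
open import Data.Sum.Base as Sum using (_⊎_; inj₁; inj₂)
open import Data.Product.Function.NonDependent.Propositional using (_×-⇔_)
open import Data.Sum.Function.Propositional using (_⊎-⇔_)
open import Data.Unit.Base using (⊤)
open import Data.Vec.Base as Vec using (Vec; []; _∷_; lookup; tabulate)
import Data.Vec.Properties as Vec
open import Function.Base using (_∘_; id; const; case_of_)
open import Function.Bundles using (mk⇔; Equivalence; Injection) renaming (_⇔_ to _⟺_)
open import Function.Construct.Composition using () renaming (_⇔-∘_ to _⟺-∘_)
open import Function.Construct.Symmetry using () renaming (⇔-sym to sym⟺)
open import Function.Properties.Inverse using (↔⇒↣)
open import Function.Related.TypeIsomorphisms using (→-cong-⇔)
open import Level using (Level; 0ℓ; Lift; lift; _⊔_) renaming (suc to lsuc)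
open import Relation.Binary.Bundles using (Poset)
open import Relation.Binary.Lattice using () renaming (IsLattice to IsOrderLattice)
open import Relation.Binary.PropositionalEquality using (_≡_; _≢_; refl; sym; trans; cong; cong₂; subst)
  renaming (isEquivalence to ≡-isEquivalence)
open import Relation.Binary.Structures using (IsEquivalence)
open import Relation.Nullary.Decidable using (Dec; yes; no; does; proof; ⌊_⌋; True; toWitness; map′;
  _×-dec_; _→-dec_; _⊎-dec_; does-⇔; dec-true; dec-false; decidable-stable)
open import Relation.Nullary.Negation using (¬_; contradiction)
open import Relation.Nullary.Reflects using (Reflects; ofʸ; ofⁿ)

private
  module BoolAlgebra = BooleanAlgebraProperties Bool.∨-∧-booleanAlgebra

-- The four-element algebra

Four : Set
Four = Bool × Bool

_≟⁴_ : (f g : Four) → Dec (f ≡ g)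
_≟⁴_ = ≡-dec Bool._≟_ Bool._≟_

fours : List Four
fours = List.cartesianProduct (1ᵇ ∷ 0ᵇ ∷ []) (1ᵇ ∷ 0ᵇ ∷ [])

∈-fours : ∀ f → f ∈ fours
∈-fours (1ᵇ , 1ᵇ) = here refl
∈-fours (1ᵇ , 0ᵇ) = there (here refl)
∈-fours (0ᵇ , 1ᵇ) = there (there (here refl))
∈-fours (0ᵇ , 0ᵇ) = there (there (there (here refl)))

∀⁴? : ∀ {p} {P : Four → Set p} → (∀ f → Dec (P f)) → Dec (∀ f → P f)
∀⁴? P? = map′ (λ ps f → All.lookup ps (∈-fours f)) (λ p → All.tabulate λ {f} _ → p f)
              (All.all? P? fours)

-- Statements quantified over 𝟜 are proved by evaluation: once `P?` computes to `yes`, the implicit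
-- argument is found automatically.
decide : ∀ {p} {P : Set p} (P? : Dec P) → {True P?} → P
decide P? {h} = toWitness h

𝟜 : Structure 0ℓ
𝟜 = record
  { Carrier       = Four
  ; _≈_           = _≡_
  ; plus          = λ (a , b) (c , d) → a ∨ᵇ c , b ∨ᵇ d
  ; times         = λ (a , b) (c , d) → a ∧ᵇ c , b ∧ᵇ d
  ; bar           = λ (a , b) → not b , not a
  ; zeroᴰ         = 0ᵇ , 0ᵇ
  ; oneᴰ          = 1ᵇ , 1ᵇ
  ; isEquivalence = ≡-isEquivalence
  ; plus-cong     = cong₂ _
  ; times-cong    = cong₂ _
  ; bar-cong      = cong _
  }

module 𝟜 = Structure 𝟜

complement : Four → Four
complement (a , b) = not a , not b

complement-unique : ∀ f g → 𝟜.plus f g ≡ 𝟜.oneᴰ → 𝟜.times f g ≡ 𝟜.zeroᴰ → g ≡ complement f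
complement-unique = decide (∀⁴? λ f → ∀⁴? λ g →
  (𝟜.plus f g ≟⁴ 𝟜.oneᴰ) →-dec ((𝟜.times f g ≟⁴ 𝟜.zeroᴰ) →-dec (g ≟⁴ complement f)))

1ᵇ≢0ᵇ : ¬ 1ᵇ ≡ 0ᵇ
1ᵇ≢0ᵇ ()

≡zero : ∀ {f : Four} → ¬ proj₁ f ≡ 1ᵇ → ¬ proj₂ f ≡ 1ᵇ → f ≡ 𝟜.zeroᴰ
≡zero p q = cong₂ _,_ (Bool.¬-not p) (Bool.¬-not q)

-- With x the value of an element at a point, ind g x is the value there of the
-- indicator of {x = g}: its first component concerns the point, its second one
-- the image of the point under the involution.
ind : Four → Four → Four
ind (a , b) (c , d) = not (a xor c) ∧ᵇ not (b xor d) , not (b xor c) ∧ᵇ not (a xor d)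

ind-sound₁ : ∀ g x → proj₁ (ind g x) ≡ 1ᵇ → g ≡ x
ind-sound₁ = decide (∀⁴? λ g → ∀⁴? λ x → (_ Bool.≟ _) →-dec (g ≟⁴ x))

ind-sound₂ : ∀ g x → proj₂ (ind g x) ≡ 1ᵇ → swap g ≡ x
ind-sound₂ g = ind-sound₁ (swap g)

ind-refl : ∀ g → proj₁ (ind g g) ≡ 1ᵇ
ind-refl = decide (∀⁴? λ g → _ Bool.≟ _)

-- The value at a point of the minterm of `e`; its second component is 1 exactly where the tuple has
-- the value `swaps e`. The factor of the head comes last, so that `Avoids (g ∷ e)` has the shape of
-- `Disjoint`.
inds : ∀ {n} → Vec Four n → Vec Four n → Four
inds []      []      = 𝟜.oneᴰ
inds (g ∷ e) (x ∷ f) = 𝟜.times (inds e f) (ind g x)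

swaps : ∀ {n} → Vec Four n → Vec Four n
swaps = Vec.map swap

swaps-involutive : ∀ {n} (e : Vec Four n) → swaps (swaps e) ≡ e
swaps-involutive []      = refl
swaps-involutive (_ ∷ e) = cong (_ ∷_) (swaps-involutive e)

inds-swaps : ∀ {n} (e f : Vec Four n) → inds (swaps e) f ≡ swap (inds e f)
inds-swaps []      []      = refl
inds-swaps (g ∷ e) (x ∷ f) rewrite inds-swaps e f = refl

∧ᵇ-split : ∀ {a b} → a ∧ᵇ b ≡ 1ᵇ → a ≡ 1ᵇ × b ≡ 1ᵇ
∧ᵇ-split {1ᵇ} {1ᵇ} _ = refl , refl

inds-sound₁ : ∀ {n} (e f : Vec Four n) → proj₁ (inds e f) ≡ 1ᵇ → e ≡ f
inds-sound₁ []      []      _ = refl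
inds-sound₁ (g ∷ e) (x ∷ f) h =
  let h₁ , h₂ = ∧ᵇ-split h in cong₂ _∷_ (ind-sound₁ g x h₂) (inds-sound₁ e f h₁)

inds-sound₂ : ∀ {n} (e f : Vec Four n) → proj₂ (inds e f) ≡ 1ᵇ → swaps e ≡ f
inds-sound₂ e f h = inds-sound₁ (swaps e) f (trans (cong proj₁ (inds-swaps e f)) h)

inds-refl : ∀ {n} (e : Vec Four n) → proj₁ (inds e e) ≡ 1ᵇ
inds-refl []      = refl
inds-refl (g ∷ e) = cong₂ _∧ᵇ_ (inds-refl e) (ind-refl g)

allVecs : ∀ n → List (Vec Four n)
allVecs zero    = [] ∷ []
allVecs (suc n) = List.cartesianProductWith _∷_ fours (allVecs n)

∈-allVecs : ∀ {n} (e : Vec Four n) → e ∈ allVecs n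
∈-allVecs []      = here refl
∈-allVecs (f ∷ e) = ∈-cartesianProductWith⁺ _∷_ (∈-fours f) (∈-allVecs e)

∀ᵛ? : ∀ {n p} {P : Vec Four n → Set p} → (∀ e → Dec (P e)) → Dec (∀ e → P e)
∀ᵛ? {n} P? = map′ (λ ps e → All.lookup ps (∈-allVecs e)) (λ p → All.tabulate λ {e} _ → p e)
                  (All.all? P? (allVecs n))

-- `swap` is an automorphism of 𝟜. Hence an equation that fails at `e` also fails at `swaps e`.
term-swaps : ∀ {n} (t : Term n) e → ⟦_⟧ 𝟜 t (swaps e) ≡ swap (⟦_⟧ 𝟜 t e)
term-swaps (var i) e = Vec.lookup-map i swap e
term-swaps (s + t) e = cong₂ 𝟜.plus (term-swaps s e) (term-swaps t e)
term-swaps (s · t) e = cong₂ 𝟜.times (term-swaps s e) (term-swaps t e)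
term-swaps (t ‾)   e = cong 𝟜.bar (term-swaps t e)
term-swaps 𝟎       e = refl
term-swaps 𝟏       e = refl

-- u · w ≐ u says that no point takes the value e, as u is the meet of the
-- literals holding at e and w the join of those failing at e.
upper lower : ∀ {m n} → Vec Four m → Vec (Term n) m → Term n
upper []            []       = 𝟏
upper ((a , b) ∷ e) (x ∷ xs) = (if a then x else 𝟏) · ((if b then 𝟏 else x ‾) · upper e xs)
lower []            []       = 𝟎
lower ((a , b) ∷ e) (x ∷ xs) = (if a then 𝟎 else x) + ((if b then x ‾ else 𝟎) + lower e xs)

avoids : ∀ {n} → Vec Four n → Formula n
avoids e = let xs = tabulate var in upper e xs · lower e xs ≐ upper e xs

-- Complementing `lower` turns each failing literal into its complement, and the two factors
-- contributed by `(a , b)` then multiply to `ind (a , b)`.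
upper-lower : ∀ {m n} (e : Vec Four m) (xs : Vec (Term n) m) f →
  𝟜.times (⟦_⟧ 𝟜 (upper e xs) f) (complement (⟦_⟧ 𝟜 (lower e xs) f)) ≡
  inds e (Vec.map (λ x → ⟦_⟧ 𝟜 x f) xs)
upper-lower []            []       f = refl
upper-lower ((a , b) ∷ e) (x ∷ xs) f =
  trans (literal a b (⟦_⟧ 𝟜 (upper e xs) f) (⟦_⟧ 𝟜 (lower e xs) f))
        (cong (λ h → 𝟜.times h (ind (a , b) (⟦_⟧ 𝟜 x f))) (upper-lower e xs f))
  where
  cases : ∀ g v u w → let a , b = g in
    𝟜.times (𝟜.times (if a then v else 𝟜.oneᴰ) (𝟜.times (if b then 𝟜.oneᴰ else 𝟜.bar v) u))
      (complement (𝟜.plus (if a then 𝟜.zeroᴰ else v) (𝟜.plus (if b then 𝟜.bar v else 𝟜.zeroᴰ) w))) ≡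
    𝟜.times (𝟜.times u (complement w)) (ind g v)
  cases = decide (∀⁴? λ g → ∀⁴? λ v → ∀⁴? λ u → ∀⁴? λ w → _ ≟⁴ _)

  literal : ∀ a b u w →
    𝟜.times (𝟜.times (⟦_⟧ 𝟜 (if a then x else 𝟏) f) (𝟜.times (⟦_⟧ 𝟜 (if b then 𝟏 else x ‾) f) u))
      (complement (𝟜.plus (⟦_⟧ 𝟜 (if a then 𝟎 else x) f) (𝟜.plus (⟦_⟧ 𝟜 (if b then x ‾ else 𝟎) f) w))) ≡
    𝟜.times (𝟜.times u (complement w)) (ind (a , b) (⟦_⟧ 𝟜 x f))
  -- Splitting on `a` and `b` lets the conditionals compute under `⟦_⟧`.
  literal 1ᵇ 0ᵇ = cases (1ᵇ , 0ᵇ) (⟦_⟧ 𝟜 x f)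
  literal 1ᵇ 1ᵇ = cases (1ᵇ , 1ᵇ) (⟦_⟧ 𝟜 x f)
  literal 0ᵇ 0ᵇ = cases (0ᵇ , 0ᵇ) (⟦_⟧ 𝟜 x f)
  literal 0ᵇ 1ᵇ = cases (0ᵇ , 1ᵇ) (⟦_⟧ 𝟜 x f)

map-tabulate-var : ∀ {n} (f : Vec Four n) → Vec.map (λ t → ⟦_⟧ 𝟜 t f) (tabulate var) ≡ f
map-tabulate-var f = trans (sym (Vec.tabulate-∘ _ _)) (Vec.tabulate∘lookup f)

-- In a Boolean lattice `u` lies below `w` exactly when it is disjoint from the complement of `w`,
-- and `upper-lower` computes that meet.
avoids-𝟜 : ∀ {n} (e f : Vec Four n) → Satisfies 𝟜 f (avoids e) ⟺ (inds e f ≡ 𝟜.zeroᴰ)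
avoids-𝟜 e f = mk⇔ (λ h → trans (sym eq) (proj₁ (below _ _) h)) (λ h → proj₂ (below _ _) (trans eq h))
  where
  eq = trans (upper-lower e (tabulate var) f) (cong (inds e) (map-tabulate-var f))
  below : ∀ u w → (𝟜.times u w ≡ u → 𝟜.times u (complement w) ≡ 𝟜.zeroᴰ) ×
                  (𝟜.times u (complement w) ≡ 𝟜.zeroᴰ → 𝟜.times u w ≡ u)
  below = decide (∀⁴? λ u → ∀⁴? λ w →
    ((_ ≟⁴ _) →-dec (_ ≟⁴ _)) ×-dec ((_ ≟⁴ _) →-dec (_ ≟⁴ _)))

-- Satisfaction of closures and finite conjunctions

module Semantics {ℓ : Level} (M : Structure ℓ) where
  open Structure M

  closure-intro : ∀ {n} (φ : Formula n) → (∀ ρ → Satisfies M ρ φ) → Satisfies M [] (closure φ)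
  closure-intro {zero}  φ h = h []
  closure-intro {suc n} φ h = closure-intro (all φ) λ ρ a → h (a ∷ ρ)

  closure-elim : ∀ {n} (φ : Formula n) → Satisfies M [] (closure φ) → ∀ ρ → Satisfies M ρ φ
  closure-elim {zero}  φ h []      = h
  closure-elim {suc n} φ h (a ∷ ρ) = closure-elim (all φ) h ρ a

  ⋀-intro : ∀ {m n} (φ : Fin m → Formula n) {ρ} → (∀ i → Satisfies M ρ (φ i)) → Satisfies M ρ (⋀ φ)
  ⋀-intro {zero}  φ h = id
  ⋀-intro {suc m} φ h = h zero , ⋀-intro (φ ∘ suc) (h ∘ suc)

  ⋀-elim : ∀ {m n} (φ : Fin m → Formula n) {ρ} → Satisfies M ρ (⋀ φ) → ∀ i → Satisfies M ρ (φ i)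
  ⋀-elim φ (h , _) zero    = h
  ⋀-elim φ (_ , h) (suc i) = ⋀-elim (φ ∘ suc) h i

  -- Each of `ψ̃`, `ξ̃`, `χ̃` ends in such a pair of conjunctions; `Reflects` turns the pair into
  -- one bit per index.
  ⋀∈-⋀∉-intro : ∀ {m n} (I : Subset m) (φ : Fin m → Formula n) {ρ} →
    (∀ i → Reflects (Satisfies M ρ (φ i)) (lookup I i)) →
    Satisfies M ρ (⋀∈ I φ ∧ ⋀∉ I (neg ∘ φ))
  ⋀∈-⋀∉-intro []       φ h = id , id
  ⋀∈-⋀∉-intro (1ᵇ ∷ I) φ h with ofʸ p ← h zero =
    let q , r = ⋀∈-⋀∉-intro I (φ ∘ suc) (h ∘ suc) in (p , q) , id , r
  ⋀∈-⋀∉-intro (0ᵇ ∷ I) φ h with ofⁿ p ← h zero =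
    let q , r = ⋀∈-⋀∉-intro I (φ ∘ suc) (h ∘ suc) in (id , q) , (λ s → contradiction s p) , r

  ⋀∈-⋀∉-elim : ∀ {m n} (I : Subset m) (φ : Fin m → Formula n) {ρ} →
    Satisfies M ρ (⋀∈ I φ ∧ ⋀∉ I (neg ∘ φ)) →
    ∀ i → Reflects (Satisfies M ρ (φ i)) (lookup I i)
  ⋀∈-⋀∉-elim (1ᵇ ∷ I) φ ((p , _) , _) zero    = ofʸ p
  ⋀∈-⋀∉-elim (0ᵇ ∷ I) φ (_ , (p , _)) zero    = ofⁿ λ s → case p s of λ ()
  ⋀∈-⋀∉-elim (_ ∷ I)  φ ((_ , p) , (_ , q)) (suc i) = ⋀∈-⋀∉-elim I (φ ∘ suc) (p , q) i

-- Sums and partitions in 𝟜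

∨ᵇ-split : ∀ {a b} → a ∨ᵇ b ≡ 1ᵇ → a ≡ 1ᵇ ⊎ b ≡ 1ᵇ
∨ᵇ-split {1ᵇ} _ = inj₁ refl
∨ᵇ-split {0ᵇ} h = inj₂ h

∑-elim : ∀ {m n} (t : Fin m → Term n) {e} → proj₁ (⟦_⟧ 𝟜 (∑ t) e) ≡ 1ᵇ →
  ∃ λ i → proj₁ (⟦_⟧ 𝟜 (t i) e) ≡ 1ᵇ
∑-elim {suc m} t h with ∨ᵇ-split h
... | inj₁ p = zero , p
... | inj₂ p = let i , q = ∑-elim (t ∘ suc) p in suc i , q

∑-intro₁ : ∀ {m n} (t : Fin m → Term n) {e} i → proj₁ (⟦_⟧ 𝟜 (t i) e) ≡ 1ᵇ →
  proj₁ (⟦_⟧ 𝟜 (∑ t) e) ≡ 1ᵇ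
∑-intro₁ t {e} zero    h = cong (_∨ᵇ proj₁ (⟦_⟧ 𝟜 (∑ (t ∘ suc)) e)) h
∑-intro₁ t {e} (suc i) h =
  trans (cong (proj₁ (⟦_⟧ 𝟜 (t zero) e) ∨ᵇ_) (∑-intro₁ (t ∘ suc) i h)) (Bool.∨-zeroʳ _)

∑-intro₂ : ∀ {m n} (t : Fin m → Term n) {e} i → proj₂ (⟦_⟧ 𝟜 (t i) e) ≡ 1ᵇ →
  proj₂ (⟦_⟧ 𝟜 (∑ t) e) ≡ 1ᵇ
∑-intro₂ t {e} zero    h = cong (_∨ᵇ proj₂ (⟦_⟧ 𝟜 (∑ (t ∘ suc)) e)) h
∑-intro₂ t {e} (suc i) h =
  trans (cong (proj₂ (⟦_⟧ 𝟜 (t zero) e) ∨ᵇ_) (∑-intro₂ (t ∘ suc) i h)) (Bool.∨-zeroʳ _)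

-- The equational part of the antecedent of `extensionAxiom`. It can be checked point by point; the
-- inequations `var i ≠ 𝟎` cannot, and are kept apart.
equations : ∀ {n} → Permutation′ n → Formula n
equations σ =
    ∑ var ≐ 𝟏
  ∧ (⋀ λ i → ⋀ λ j → if ⌊ i Fin.≟ j ⌋ then Defs.true else var i · var j ≐ 𝟎)
  ∧ (⋀ λ i → var i ‾ + var (σ ⟨$⟩ʳ i) ≐ 𝟏 ∧ var i ‾ · var (σ ⟨$⟩ʳ i) ≐ 𝟎)

-- Here `e` lists the values of the yᵢ at one point. Covering and disjointness concern first
-- components; `swapped` carries them over to the second ones.
record Partition {n} (σ : Permutation′ n) (e : Vec Four n) : Set where
  field
    covers   : ∃ λ i → proj₁ (lookup e i) ≡ 1ᵇ
    disjoint : ∀ {i j} → proj₁ (lookup e i) ≡ 1ᵇ → proj₁ (lookup e j) ≡ 1ᵇ → i ≡ j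
    swapped  : ∀ i → lookup e (σ ⟨$⟩ʳ i) ≡ swap (lookup e i)

  swapped₂ : ∀ i → proj₂ (lookup e i) ≡ 1ᵇ → proj₁ (lookup e (σ ⟨$⟩ʳ i)) ≡ 1ᵇ
  swapped₂ i h = trans (cong proj₁ (swapped i)) h

equations⇒partition : ∀ {n} (σ : Permutation′ n) e → Satisfies 𝟜 e (equations σ) → Partition σ e
equations⇒partition σ e (sum , dis , swp) = record
  { covers   = ∑-elim var {e} (cong proj₁ sum)
  ; disjoint = λ {i} {j} → disjoint i j (⋀-elim _ (⋀-elim _ dis i) j)
  -- The element at `σ i` is the complement of the bar of the element at `i`, and complement after
  -- bar is `swap`.
  ; swapped  = λ i → let p , q = ⋀-elim _ swp i in trans (complement-unique _ _ p q) (complement-bar _)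
  }
  where
  open Semantics 𝟜
  complement-bar : ∀ f → complement (𝟜.bar f) ≡ swap f
  complement-bar = decide (∀⁴? λ f → _ ≟⁴ _)
  disjoint : ∀ i j → Satisfies 𝟜 e (if ⌊ i Fin.≟ j ⌋ then Defs.true else var i · var j ≐ 𝟎) →
    proj₁ (lookup e i) ≡ 1ᵇ → proj₁ (lookup e j) ≡ 1ᵇ → i ≡ j
  disjoint i j h p q with i Fin.≟ j
  ... | yes i≡j = i≡j
  ... | no  _   = case trans (sym (cong₂ _∧ᵇ_ p q)) (cong proj₁ h) of λ ()

partition⇒equations : ∀ {n} (σ : Permutation′ n) e → Partition σ e → Satisfies 𝟜 e (equations σ)
partition⇒equations σ e part =
    cong₂ _,_ (∑-intro₁ var {e} (proj₁ covers) (proj₂ covers))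
              (∑-intro₂ var {e} (σ ⟨$⟩ʳ proj₁ covers)
                 (trans (cong proj₂ (swapped _)) (proj₂ covers)))
  , ⋀-intro _ (λ i → ⋀-intro _ λ j → orthogonal i j)
  , ⋀-intro _ λ i → subst (λ g → 𝟜.plus (𝟜.bar (lookup e i)) g ≡ 𝟜.oneᴰ × 𝟜.times (𝟜.bar (lookup e i)) g ≡ 𝟜.zeroᴰ)
                          (sym (swapped i)) (swap-complement (lookup e i))
  where
  open Semantics 𝟜
  open Partition part
  swap-complement : ∀ f → 𝟜.plus (𝟜.bar f) (swap f) ≡ 𝟜.oneᴰ × 𝟜.times (𝟜.bar f) (swap f) ≡ 𝟜.zeroᴰ
  swap-complement = decide (∀⁴? λ f → (_ ≟⁴ _) ×-dec (_ ≟⁴ _))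
  orthogonal : ∀ i j → Satisfies 𝟜 e (if ⌊ i Fin.≟ j ⌋ then Defs.true else var i · var j ≐ 𝟎)
  orthogonal i j with i Fin.≟ j
  ... | yes _  = id
  ... | no i≢j = ≡zero
    (λ h → let p , q = ∧ᵇ-split h in i≢j (disjoint p q))
    -- Second components at `i` and `j` are first components at their images under `σ`, so these
    -- images coincide.
    (λ h → let p , q = ∧ᵇ-split h in i≢j (Injection.injective (↔⇒↣ σ) (disjoint (swapped₂ i p) (swapped₂ j q))))

-- Conjunctions of equations: their truth in a represented algebra is eventual truth of the values.
-- The constructor `true` covers the end of every `⋀` and the diagonal of the disjointness clause.
data Equational {n : ℕ} : Formula n → Set where
  _≐_  : ∀ s t → Equational (s ≐ t)
  true : Equational Defs.true
  _∧_  : ∀ {φ ψ} → Equational φ → Equational ψ → Equational (φ ∧ ψ)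

⋀-equational : ∀ {m n} {φ : Fin m → Formula n} → (∀ i → Equational (φ i)) → Equational (⋀ φ)
⋀-equational {zero}  h = true
⋀-equational {suc m} h = h zero ∧ ⋀-equational (h ∘ suc)

equations-equational : ∀ {n} (σ : Permutation′ n) → Equational (equations σ)
equations-equational {n} σ =
    (_ ≐ _)
  ∧ (⋀-equational {n} (λ i → ⋀-equational {n} λ j → orthogonal ⌊ i Fin.≟ j ⌋ (var i · var j) 𝟎)
  ∧ ⋀-equational {n} λ i → (var i ‾ + var (σ ⟨$⟩ʳ i) ≐ 𝟏) ∧ (var i ‾ · var (σ ⟨$⟩ʳ i) ≐ 𝟎))
  where
  orthogonal : ∀ b (s t : Term n) → Equational (if b then Defs.true else s ≐ t)
  orthogonal 1ᵇ _ _ = true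
  orthogonal 0ᵇ s t = s ≐ t

avoids-equational : ∀ {n} (e : Vec Four n) → Equational (avoids e)
avoids-equational e = _ ≐ _

⟺-trans : ∀ {a b c} {A : Set a} {B : Set b} {C : Set c} → A ⟺ B → B ⟺ C → A ⟺ C
⟺-trans f g = g ⟺-∘ f

reflects-⟺ : ∀ {a b} {A : Set a} {B : Set b} {c} → A ⟺ B → Reflects A c → Reflects B c
reflects-⟺ h (ofʸ a)  = ofʸ (Equivalence.to h a)
reflects-⟺ h (ofⁿ ¬a) = ofⁿ (¬a ∘ Equivalence.from h)

reflects-unique : ∀ {a b} {A : Set a} {B : Set b} {c} → Reflects A c → Reflects B c → A ⟺ B
reflects-unique (ofʸ a)  (ofʸ b)  = mk⇔ (const b) (const a)
reflects-unique (ofⁿ ¬a) (ofⁿ ¬b) = mk⇔ (λ a → contradiction a ¬a) (λ b → contradiction b ¬b)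

-- Representation by 𝟜-valued functions

-- The sets of points at which some stage holds form a base of a filter, and `Eventually` is
-- membership in that filter. Properness is a separate hypothesis, stated where nontriviality is
-- proved.
record FilterBase (ℓ : Level) : Set (lsuc ℓ) where
  field
    Point Stage : Set ℓ
    Holds       : Stage → Point → Set ℓ
    ⊤ˢ          : Stage
    _⊓ˢ_        : Stage → Stage → Stage
    ⊓ˢ-holds    : ∀ k l {p} → Holds (k ⊓ˢ l) p → Holds k p × Holds l p

  Eventually : ∀ {q} → (Point → Set q) → Set (ℓ ⊔ q)
  Eventually Q = ∃ λ k → ∀ {p} → Holds k p → Q p

  module _ {q r} {Q : Point → Set q} {R : Point → Set r} where

    ev-map : (∀ {p} → Q p → R p) → Eventually Q → Eventually R
    ev-map f (k , h) = k , f ∘ h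

    ev-zip : ∀ {s} {S : Point → Set s} →
      (∀ {p} → Q p → R p → S p) → Eventually Q → Eventually R → Eventually S
    ev-zip f (k , g) (l , h) = (k ⊓ˢ l) , λ kl →
      let hk , hl = ⊓ˢ-holds k l kl in f (g hk) (h hl)

  always : ∀ {q} {Q : Point → Set q} → (∀ p → Q p) → Eventually Q
  always h = ⊤ˢ , λ {p} _ → h p

  ev-∀∈ : ∀ {a q} {A : Set a} {Q : A → Point → Set q} (xs : List A) →
    (∀ x → Eventually (Q x)) → Eventually (λ p → ∀ {x} → x ∈ xs → Q x p)
  ev-∀∈ []       h = always λ _ ()
  ev-∀∈ (x ∷ xs) h = ev-zip (λ { q qs (here refl) → q ; q qs (there i) → qs i }) (h x) (ev-∀∈ xs h)

  ev-≡⟺ : ∀ {a} {A : Set a} (f g : Point → A) {z} → Eventually (λ p → f p ≡ g p) →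
    Eventually (λ p → f p ≡ z) ⟺ Eventually (λ p → g p ≡ z)
  ev-≡⟺ f g h = mk⇔ (ev-zip (λ e → trans (sym e)) h) (ev-zip trans h)

-- A single `val p` need not be a homomorphism: each law holds from a stage on that may depend on
-- the elements involved. This suffices because a term involves only finitely many of them.
record Representation {ℓ} (M : Structure ℓ) : Set (lsuc ℓ) where
  open Structure M
  field
    base       : FilterBase ℓ
  open FilterBase base public
  field
    val        : Point → Carrier → Four
    val-cong   : ∀ {a b} → a ≈ b → Eventually λ p → val p a ≡ val p b
    separating : ∀ {a b} → Eventually (λ p → val p a ≡ val p b) → a ≈ b
    val-plus   : ∀ a b → Eventually λ p → val p (plus a b) ≡ 𝟜.plus (val p a) (val p b)
    val-times  : ∀ a b → Eventually λ p → val p (times a b) ≡ 𝟜.times (val p a) (val p b)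
    val-bar    : ∀ a → Eventually λ p → val p (bar a) ≡ 𝟜.bar (val p a)
    val-zero   : Eventually λ p → val p zeroᴰ ≡ 𝟜.zeroᴰ
    val-one    : Eventually λ p → val p oneᴰ ≡ 𝟜.oneᴰ

  vals : ∀ {n} → Point → Vec Carrier n → Vec Four n
  vals p = Vec.map (val p)

  eval : ∀ {n} (t : Term n) ρ → Eventually λ p → val p (⟦_⟧ M t ρ) ≡ ⟦_⟧ 𝟜 t (vals p ρ)
  eval (var i) ρ = always λ p → sym (Vec.lookup-map i (val p) ρ)
  eval (s + t) ρ = ev-zip trans (val-plus _ _) (ev-zip (cong₂ 𝟜.plus) (eval s ρ) (eval t ρ))
  eval (s · t) ρ = ev-zip trans (val-times _ _) (ev-zip (cong₂ 𝟜.times) (eval s ρ) (eval t ρ))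
  eval (t ‾)   ρ = ev-zip trans (val-bar _) (ev-map (cong 𝟜.bar) (eval t ρ))
  eval 𝟎       ρ = val-zero
  eval 𝟏       ρ = val-one

  equational : ∀ {n} {φ : Formula n} → Equational φ → ∀ ρ →
    Satisfies M ρ φ ⟺ Eventually (λ p → Satisfies 𝟜 (vals p ρ) φ)
  equational (s ≐ t) ρ = mk⇔
    (λ h → ev-zip (λ (p , q) r → trans (sym p) (trans r q)) (ev-zip _,_ (eval s ρ) (eval t ρ)) (val-cong h))
    (λ h → separating (ev-zip (λ (p , q) r → trans p (trans r (sym q))) (ev-zip _,_ (eval s ρ) (eval t ρ)) h))
  equational true    ρ = mk⇔ (λ _ → always λ _ → id) (λ _ → id)
  equational (φ ∧ ψ) ρ =
    ⟺-trans (equational φ ρ ×-⇔ equational ψ ρ) (mk⇔ (uncurry (ev-zip _,_)) λ h → ev-map proj₁ h , ev-map proj₂ h)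

  Avoids : ∀ {n} → Vec Four n → Vec Carrier n → Set ℓ
  Avoids e ρ = Eventually λ p → inds e (vals p ρ) ≡ 𝟜.zeroᴰ

  avoids⟺Avoids : ∀ {n} (e : Vec Four n) ρ → Satisfies M ρ (avoids e) ⟺ Avoids e ρ
  avoids⟺Avoids e ρ = mk⇔
    (ev-map (Equivalence.to (avoids-𝟜 e _)) ∘ Equivalence.to (equational (avoids-equational e) ρ))
    (Equivalence.from (equational (avoids-equational e) ρ) ∘ ev-map (Equivalence.from (avoids-𝟜 e _)))

  zero⟺ : ∀ {a} {f : Point → Four} → Eventually (λ p → val p a ≡ f p) →
    a ≈ zeroᴰ ⟺ Eventually (λ p → f p ≡ 𝟜.zeroᴰ)
  zero⟺ a≡f = mk⇔
    (λ h → ev-zip (λ (p , q) r → trans (sym q) (trans r p)) (ev-zip _,_ val-zero a≡f) (val-cong h))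
    (λ h → separating (ev-zip (λ (p , q) r → trans q (trans r (sym p))) (ev-zip _,_ val-zero a≡f) h))

  val-complement : ∀ {a b} → plus a b ≈ oneᴰ → times a b ≈ zeroᴰ →
    Eventually λ p → val p b ≡ complement (val p a)
  val-complement {a} {b} h k = ev-zip (complement-unique _ _)
    (Equivalence.to (equational (var zero + var (suc zero) ≐ 𝟏) (a ∷ b ∷ [])) h)
    (Equivalence.to (equational (var zero · var (suc zero) ≐ 𝟎) (a ∷ b ∷ [])) k)

  Disjoint : Carrier → Four → Carrier → Set ℓ
  Disjoint y g x = Eventually λ p → 𝟜.times (val p y) (ind g (val p x)) ≡ 𝟜.zeroᴰ

  disjoint⟺ : ∀ {w} g x y → Eventually (λ p → val p w ≡ ind g (val p x)) →
    times y w ≈ zeroᴰ ⟺ Disjoint y g x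
  disjoint⟺ g x y h = zero⟺ (ev-zip (λ p q → trans p (cong (𝟜.times _) q)) (val-times y _) h)

-- Cells in complemented algebras

module Complemented {ℓ} {M : Structure ℓ} (isModel : IsModel M ComplementedDeMorgan)
                    (rep : Representation M) where
  open Structure M
  open Representation rep
  open Semantics M

  ∼ : Carrier → Carrier
  ∼ a = proj₁ (isModel _ complemented a)

  val-∼ : ∀ a → Eventually λ p → val p (∼ a) ≡ complement (val p a)
  val-∼ a = let _ , p , q = isModel _ complemented a in val-complement q p

  -- Complements being unique, the three products in `ψ̃`, `ξ̃`, `χ̃` are the indicators of the
  -- values (1,0), (1,1) and (0,0) of `x`. The value (0,1) is the mirror image of (1,0) under the
  -- involution.
  φ̃⟺ : ∀ {n} (I₁ I₂ I₃ : Subset n) x (ys : Vec Carrier n) →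
    Satisfies M (x ∷ ys) (φ̃ I₁ I₂ I₃) ⟺ (∀ i →
      Reflects (Disjoint (lookup ys i) (1ᵇ , 0ᵇ) x) (lookup I₁ i) ×
      Reflects (Disjoint (lookup ys i) (1ᵇ , 1ᵇ) x) (lookup I₂ i) ×
      Reflects (Disjoint (lookup ys i) (0ᵇ , 0ᵇ) x) (lookup I₃ i))
  φ̃⟺ I₁ I₂ I₃ x ys = mk⇔
    (λ (ψ , (z , ξ₁ , ξ₂ , ξ) , (z′ , χ₁ , χ₂ , χ)) i →
        reflects-⟺ (disjoint⟺ (1ᵇ , 0ᵇ) x _ val-ψ)
          (⋀∈-⋀∉-elim I₁ (λ i → var (suc i) · (var zero · var zero ‾) ≐ 𝟎) ψ i)
      , reflects-⟺ (disjoint⟺ (1ᵇ , 1ᵇ) x _ (val-ξ ξ₁ ξ₂))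
          (⋀∈-⋀∉-elim I₂ (λ i → var (suc (suc i)) · (var (suc zero) · var zero) ≐ 𝟎) ξ i)
      , reflects-⟺ (disjoint⟺ (0ᵇ , 0ᵇ) x _ (val-χ χ₁ χ₂))
          (⋀∈-⋀∉-elim I₃ (λ i → var (suc (suc i)) · (var zero · var (suc zero) ‾) ≐ 𝟎) χ i))
    (λ h →
      let _ , ξ₂ , ξ₁ = isModel _ complemented (bar x)
          _ , χ₂ , χ₁ = isModel _ complemented x
      in
        ⋀∈-⋀∉-intro I₁ _ (λ i → reflects-⟺ (sym⟺ (disjoint⟺ (1ᵇ , 0ᵇ) x _ val-ψ)) (proj₁ (h i)))
      , (_ , ξ₁ , ξ₂ , ⋀∈-⋀∉-intro I₂ _ λ i →
          reflects-⟺ (sym⟺ (disjoint⟺ (1ᵇ , 1ᵇ) x _ (val-ξ ξ₁ ξ₂))) (proj₁ (proj₂ (h i))))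
      , (_ , χ₁ , χ₂ , ⋀∈-⋀∉-intro I₃ _ λ i →
          reflects-⟺ (sym⟺ (disjoint⟺ (0ᵇ , 0ᵇ) x _ (val-χ χ₁ χ₂))) (proj₂ (proj₂ (h i)))))
    where
    val-ψ : Eventually λ p → val p (times x (bar x)) ≡ ind (1ᵇ , 0ᵇ) (val p x)
    val-ψ = ev-zip (λ {p} q r → trans q (trans (cong (𝟜.times _) r) (cell (val p x)))) (val-times _ _) (val-bar x)
      where
      cell : ∀ f → 𝟜.times f (𝟜.bar f) ≡ ind (1ᵇ , 0ᵇ) f
      cell = decide (∀⁴? λ _ → _ ≟⁴ _)

    val-ξ : ∀ {z} → plus (bar x) z ≈ oneᴰ → times (bar x) z ≈ zeroᴰ →
      Eventually λ p → val p (times x z) ≡ ind (1ᵇ , 1ᵇ) (val p x)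
    val-ξ h k = ev-zip (λ { {p} (q , r) s → trans q (trans (cong (𝟜.times _) (trans s (cong complement r))) (cell (val p x))) })
      (ev-zip _,_ (val-times _ _) (val-bar x)) (val-complement h k)
      where
      cell : ∀ f → 𝟜.times f (complement (𝟜.bar f)) ≡ ind (1ᵇ , 1ᵇ) f
      cell = decide (∀⁴? λ _ → _ ≟⁴ _)

    val-χ : ∀ {z} → plus x z ≈ oneᴰ → times x z ≈ zeroᴰ →
      Eventually λ p → val p (times z (bar x)) ≡ ind (0ᵇ , 0ᵇ) (val p x)
    val-χ h k = ev-zip (λ { {p} (q , r) s → trans q (trans (cong₂ 𝟜.times s r) (cell (val p x))) })
      (ev-zip _,_ (val-times _ _) (val-bar x)) (val-complement h k)
      where
      cell : ∀ f → 𝟜.times (complement f) (𝟜.bar f) ≡ ind (0ᵇ , 0ᵇ) f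
      cell = decide (∀⁴? λ _ → _ ≟⁴ _)

  literal : ∀ g a → ∃ λ b → Eventually λ p → val p b ≡ ind g (val p a)
  literal (c , d) a = _ , ev-zip (λ { {p} (q , r) s → trans s (trans (cong₂ 𝟜.times q r) (product (c , d) (val p a))) })
    (ev-zip _,_ (factor₁ c) (factor₂ d)) (val-times (if c then a else ∼ a) (if d then ∼ (bar a) else bar a))
    where
    factor₁ : ∀ c → Eventually λ p → val p (if c then a else ∼ a) ≡ (if c then val p a else complement (val p a))
    factor₁ 1ᵇ = always λ _ → refl
    factor₁ 0ᵇ = val-∼ a
    factor₂ : ∀ d → Eventually λ p →
      val p (if d then ∼ (bar a) else bar a) ≡ (if d then complement (𝟜.bar (val p a)) else 𝟜.bar (val p a))
    factor₂ 1ᵇ = ev-zip (λ p q → trans p (cong complement q)) (val-∼ (bar a)) (val-bar a)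
    factor₂ 0ᵇ = val-bar a
    product : ∀ g f → 𝟜.times (if proj₁ g then f else complement f)
                           (if proj₂ g then complement (𝟜.bar f) else 𝟜.bar f) ≡ ind g f
    product = decide (∀⁴? λ _ → ∀⁴? λ _ → _ ≟⁴ _)

  -- The minterms of `ρ`; the nonzero ones are the yᵢ to which the extension axioms are applied.
  cell : ∀ {n} (e : Vec Four n) ρ → ∃ λ y → Eventually λ p → val p y ≡ inds e (vals p ρ)
  cell []      []      = oneᴰ , val-one
  cell (g ∷ e) (a ∷ ρ) =
    let _ , p = cell e ρ
        _ , q = literal g a
    in -, ev-zip trans (val-times _ _) (ev-zip (cong₂ 𝟜.times) p q)

-- Models of ECDA

-- Definition by cases over the cell that contains the point. The default zero is reached only where
-- no cell does, hence not where `Partition` holds.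
select : ∀ {n} → Vec Four n → (Fin n → Four) → Four
select []      h = 𝟜.zeroᴰ
select (f ∷ e) h = if proj₁ f then h zero else select e (h ∘ suc)

select-unique : ∀ {n} (e : Vec Four n) h →
  (∀ {i j} → proj₁ (lookup e i) ≡ 1ᵇ → proj₁ (lookup e j) ≡ 1ᵇ → i ≡ j) →
  ∀ i → proj₁ (lookup e i) ≡ 1ᵇ → select e h ≡ h i
select-unique ((1ᵇ , _) ∷ e) h unique i       p = cong h (unique {zero} refl p)
select-unique ((0ᵇ , _) ∷ e) h unique (suc i) p =
  select-unique e (h ∘ suc) (λ q r → Fin.suc-injective (unique q r)) i p

-- A generalised consistent triple: I g i says that the i-th cell misses the
-- part where x takes the value g, so that I (0ᵇ , 1ᵇ) is redundant.
record Pattern {n} (σ : Permutation′ n) (I : Four → Fin n → Bool) : Set where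
  field
    symmetric : ∀ g i → I (swap g) (σ ⟨$⟩ʳ i) ≡ I g i
    inhabited : ∀ i → ∃ λ g → I g i ≡ 0ᵇ

-- The functions Point × Four^ℕ → 𝟜 that depend on finitely many of the
-- coordinates in Four^ℕ, modulo the filter of B.  The unused coordinates
-- split every nonzero cell.
module LocalFunctions {ℓ : Level} (B : FilterBase ℓ) where

  open FilterBase B

  record LocalFunction : Set ℓ where
    field
      at    : Point → (ℕ → Four) → Four
      bound : ℕ
      local : ∀ p {τ τ′} → (∀ {i} → i < bound → τ i ≡ τ′ i) → at p τ ≡ at p τ′

  open LocalFunction

  constant : Four → LocalFunction
  constant c = record { at = λ _ _ → c ; bound = 0 ; local = λ _ _ → refl }

  lift₁ : (Four → Four) → LocalFunction → LocalFunction
  lift₁ op f = record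
    { at    = λ p τ → op (at f p τ)
    ; bound = bound f
    ; local = λ p h → cong op (local f p h)
    }

  lift₂ : (Four → Four → Four) → LocalFunction → LocalFunction → LocalFunction
  lift₂ op f g = record
    { at    = λ p τ → op (at f p τ) (at g p τ)
    ; bound = bound f ℕ.⊔ bound g
    ; local = λ p h → cong₂ op (local f p λ i< → h (ℕ.<-≤-trans i< (ℕ.m≤m⊔n _ _)))
                               (local g p λ i< → h (ℕ.<-≤-trans i< (ℕ.m≤n⊔m (bound f) _)))
    }

  -- Stages put no condition on the coordinates, so what holds eventually holds for all `τ` at once.
  extended : FilterBase ℓ
  extended = record
    { Point    = Point × (ℕ → Four)
    ; Stage    = Stage
    ; Holds    = λ k (p , _) → Holds k p
    ; ⊤ˢ       = ⊤ˢ
    ; _⊓ˢ_     = _⊓ˢ_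
    ; ⊓ˢ-holds = λ k l → ⊓ˢ-holds k l
    }

  module E = FilterBase extended

  structure : Structure ℓ
  structure = record
    { Carrier       = LocalFunction
    ; _≈_           = λ f g → E.Eventually λ (p , τ) → at f p τ ≡ at g p τ
    ; plus          = lift₂ 𝟜.plus
    ; times         = lift₂ 𝟜.times
    ; bar           = lift₁ 𝟜.bar
    ; zeroᴰ         = constant 𝟜.zeroᴰ
    ; oneᴰ          = constant 𝟜.oneᴰ
    ; isEquivalence = record
      { refl  = E.always λ _ → refl
      ; sym   = E.ev-map sym
      ; trans = E.ev-zip trans
      }
    ; plus-cong     = E.ev-zip (cong₂ 𝟜.plus)
    ; times-cong    = E.ev-zip (cong₂ 𝟜.times)
    ; bar-cong      = E.ev-map (cong 𝟜.bar)
    }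

  open Structure structure using (_≈_; zeroᴰ)

  representation : Representation structure
  representation = record
    { base       = extended
    ; val        = λ (p , τ) f → at f p τ
    ; val-cong   = id
    ; separating = id
    ; val-plus   = λ _ _ → E.always λ _ → refl
    ; val-times  = λ _ _ → E.always λ _ → refl
    ; val-bar    = λ _ → E.always λ _ → refl
    ; val-zero   = E.always λ _ → refl
    ; val-one    = E.always λ _ → refl
    }

  open Representation representation using (val; vals; Disjoint; equational)

  commonBound : ∀ {n} (fs : Vec LocalFunction n) → ∃ λ N → ∀ i → bound (lookup fs i) ≤ N
  commonBound []       = 0 , λ ()
  commonBound (f ∷ fs) with commonBound fs
  ... | N , h = bound f ℕ.⊔ N , λ
    { zero    → ℕ.m≤m⊔n _ N
    ; (suc i) → ℕ.≤-trans (h i) (ℕ.m≤n⊔m (bound f) N)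
    }

  vals-local : ∀ {n} (fs : Vec LocalFunction n) N → (∀ i → bound (lookup fs i) ≤ N) →
    ∀ p {τ τ′} → (∀ {i} → i < N → τ i ≡ τ′ i) → vals (p , τ) fs ≡ vals (p , τ′) fs
  vals-local []       N bs p h = refl
  vals-local (f ∷ fs) N bs p h =
    cong₂ _∷_ (local f p λ i< → h (ℕ.<-≤-trans i< (bs zero))) (vals-local fs N (bs ∘ suc) p h)

  open Semantics structure

  -- An identity in three variables is evaluated at all 64 triples of 𝟜 and then holds at every
  -- point.
  law : (s t : Term 3) → {True (∀ᵛ? λ e → ⟦_⟧ 𝟜 s e ≟⁴ ⟦_⟧ 𝟜 t e)} →
    Satisfies structure [] (closure (s ≐ t))
  law s t {h} = closure-intro (s ≐ t) λ ρ →
    Equivalence.from (equational (s ≐ t) ρ) (E.always λ p → toWitness h (vals p ρ))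

  isComplementedDeMorgan : (∀ k → ∃ λ p → Holds k p) → IsModel structure ComplementedDeMorgan
  isComplementedDeMorgan proper = λ
    { _ (deMorgan +-comm)      → law (x + y) (y + x)
    ; _ (deMorgan +-assoc)     → law ((x + y) + z) (x + (y + z))
    ; _ (deMorgan ·-comm)      → law (x · y) (y · x)
    ; _ (deMorgan ·-assoc)     → law ((x · y) · z) (x · (y · z))
    ; _ (deMorgan +-absorbs-·) → law (x + x · y) x
    ; _ (deMorgan ·-absorbs-+) → law (x · (x + y)) x
    ; _ (deMorgan +-distrib-·) → law (x + y · z) ((x + y) · (x + z))
    ; _ (deMorgan ·-distrib-+) → law (x · (y + z)) (x · y + x · z)
    ; _ (deMorgan +-zero)      → law (x + 𝟎) x
    ; _ (deMorgan ·-one)       → law (x · 𝟏) x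
    ; _ (deMorgan bar-invol)   → law ((x ‾) ‾) x
    ; _ (deMorgan bar-plus)    → law ((x + y) ‾) (x ‾ · y ‾)
    ; _ (deMorgan zero≠one)    → λ (k , h) → case h {proj₁ (proper k) , λ _ → 𝟜.zeroᴰ} (proj₂ (proper k)) of λ ()
    ; _ complemented           → λ a → lift₁ complement a
        , E.always (λ (p , τ) → proj₁ (complement-law (at a p τ)))
        , E.always (λ (p , τ) → proj₂ (complement-law (at a p τ)))
    }
    where
    x y z : Term 3
    x = var zero
    y = var (suc zero)
    z = var (suc (suc zero))
    complement-law : ∀ f → 𝟜.times f (complement f) ≡ 𝟜.zeroᴰ × 𝟜.plus f (complement f) ≡ 𝟜.oneᴰ
    complement-law = decide (∀⁴? λ f → (_ ≟⁴ _) ×-dec (_ ≟⁴ _))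

  module Extension {n : ℕ} (σ : Permutation′ n) (I : Four → Fin n → Bool)
                   (pattern′ : Pattern σ I) (ys : Vec LocalFunction n)
                   (partition : E.Eventually λ p → Partition σ (vals p ys))
                   (nonzero : ∀ i → ¬ lookup ys i ≈ zeroᴰ) where

    open Pattern pattern′

    N : ℕ
    N = proj₁ (commonBound ys)

    force : Fin n → Four → Four
    force i g = if I g i then proj₁ (inhabited i) else g

    force-allowed : ∀ i g → I (force i g) i ≡ 0ᵇ
    force-allowed i g with I g i in eq
    ... | 1ᵇ = proj₂ (inhabited i)
    ... | 0ᵇ = eq

    force-id : ∀ i g → I g i ≡ 0ᵇ → force i g ≡ g
    force-id i g h rewrite h = refl

    -- On the i-th cell the witness follows coordinate `N`, which none of the `ys` reads, corrected
    -- by `force` where the pattern forbids the value. So forbidden values do not occur, while each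
    -- allowed one occurs for a suitable coordinate.
    witness : LocalFunction
    witness = record
      { at    = λ p τ → select (vals (p , τ) ys) λ i → force i (τ N)
      ; bound = suc N
      ; local = λ p h → cong₂ (λ e g → select e λ i → force i g)
          (vals-local ys N (proj₂ (commonBound ys)) p (λ i< → h (ℕ.m<n⇒m<1+n i<)))
          (h ℕ.≤-refl)
      }

    at-witness : ∀ {p} → Partition σ (vals p ys) → ∀ i → proj₁ (lookup (vals p ys) i) ≡ 1ᵇ →
      val p witness ≡ force i (proj₂ p N)
    at-witness {p} part = select-unique (vals p ys) _ (Partition.disjoint part)

    misses : ∀ g i → I g i ≡ 1ᵇ → Disjoint (lookup ys i) g witness
    misses g i Ig = E.ev-map (λ {p} part → subst (λ y → 𝟜.times y (ind g (val p witness)) ≡ 𝟜.zeroᴰ)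
                                 (Vec.lookup-map i (val p) ys) (zero-at part)) partition
      where
      zero-at : ∀ {p} → Partition σ (vals p ys) →
        𝟜.times (lookup (vals p ys) i) (ind g (val p witness)) ≡ 𝟜.zeroᴰ
      zero-at {p} part = ≡zero
        (λ h → let h₁ , h₂ = ∧ᵇ-split h in
          1ᵇ≢0ᵇ (trans (sym Ig) (trans (cong (λ f → I f i) (trans (ind-sound₁ g _ h₂) (at-witness part i h₁)))
                                        (force-allowed i _))))
        -- A second component equal to 1 puts the point into cell `σ i` with value `swap g`, which
        -- `symmetric` forbids there.
        (λ h → let h₁ , h₂ = ∧ᵇ-split h ; σi = σ ⟨$⟩ʳ i in
          1ᵇ≢0ᵇ (trans (sym Ig) (trans (sym (symmetric g i))
            (trans (cong (λ f → I f σi) (trans (ind-sound₂ g _ h₂)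
                     (at-witness part σi (Partition.swapped₂ part i h₁))))
                   (force-allowed σi _)))))

    override : (ℕ → Four) → Four → ℕ → Four
    override τ g j = if ⌊ j ℕ.≟ N ⌋ then g else τ j

    override-N : ∀ τ g → override τ g N ≡ g
    override-N τ g with N ℕ.≟ N
    ... | yes _  = refl
    ... | no N≢N = contradiction refl N≢N

    override-< : ∀ τ g {j} → j < N → τ j ≡ override τ g j
    override-< τ g {j} j<N with j ℕ.≟ N
    ... | yes j≡N = contradiction j≡N (ℕ.<⇒≢ j<N)
    ... | no _    = refl

    vals-override : ∀ {p} τ g → vals (p , τ) ys ≡ vals (p , override τ g) ys
    vals-override τ g = vals-local ys N (proj₂ (commonBound ys)) _ (override-< τ g)

    -- Resetting coordinate `N` to `g` at a point of the cell leaves the `ys` unchanged and gives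
    -- the witness the value `g`. If that value were missed, the cell would be empty, against
    -- `nonzero`.
    meets : ∀ g i → I g i ≡ 0ᵇ → ¬ Disjoint (lookup ys i) g witness
    meets g i Ig disjoint = nonzero i
      (E.ev-zip (λ part d → trans (sym (Vec.lookup-map i _ ys)) (zero-at part d))
                (every-τ partition) (every-τ disjoint))
      where
      every-τ : ∀ {q} {Q : Point × (ℕ → Four) → Set q} →
        E.Eventually Q → E.Eventually λ (p , _) → ∀ τ → Q (p , τ)
      every-τ (k , h) = k , λ hk τ → h hk

      zero-at : ∀ {p τ} → (∀ τ → Partition σ (vals (p , τ) ys)) →
        (∀ τ → 𝟜.times (val (p , τ) (lookup ys i)) (ind g (val (p , τ) witness)) ≡ 𝟜.zeroᴰ) →
        lookup (vals (p , τ) ys) i ≡ 𝟜.zeroᴰ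
      zero-at {p} {τ} part d = ≡zero
        (λ h → let τ′ = override τ g
                   h′ = trans (cong (λ e → proj₁ (lookup e i)) (sym (vals-override τ g))) h
                   x≡ = trans (at-witness (part τ′) i h′) (trans (cong (force i) (override-N τ g)) (force-id i g Ig))
          in 1ᵇ≢0ᵇ (trans (sym (cong₂ _∧ᵇ_ h′ (trans (cong (λ x → proj₁ (ind g x)) x≡) (ind-refl g))))
                          (cong proj₁ (d′ τ′))))
        -- Here the point lies in cell `σ i`, where `swap g` is allowed by symmetry and makes the
        -- second component of `ind g` equal to 1.
        (λ h → let τ′ = override τ (swap g)
                   h′ = trans (cong (λ e → proj₂ (lookup e i)) (sym (vals-override τ (swap g)))) h
                   x≡ = trans (at-witness (part τ′) (σ ⟨$⟩ʳ i) (Partition.swapped₂ (part τ′) i h′))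
                              (trans (cong (force _) (override-N τ (swap g)))
                                     (force-id _ (swap g) (trans (symmetric g i) Ig)))
          in 1ᵇ≢0ᵇ (trans (sym (cong₂ _∧ᵇ_ h′ (trans (cong (λ x → proj₂ (ind g x)) x≡) (ind-refl (swap g)))))
                          (cong proj₂ (d′ τ′))))
        where
        d′ : ∀ τ → 𝟜.times (lookup (vals (p , τ) ys) i) (ind g (val (p , τ) witness)) ≡ 𝟜.zeroᴰ
        d′ τ = trans (cong (λ y → 𝟜.times y (ind g (val (p , τ) witness))) (Vec.lookup-map i (val (p , τ)) ys)) (d τ)

    realizes : ∃ λ x → ∀ g i → Reflects (Disjoint (lookup ys i) g x) (I g i)
    realizes = witness , reflects
      where
      reflects : ∀ g i → Reflects (Disjoint (lookup ys i) g witness) (I g i)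
      reflects g i with I g i in eq
      ... | 1ᵇ = ofʸ (misses g i eq)
      ... | 0ᵇ = ofⁿ (meets g i eq)

-- Consistent triples as patterns

∩₃-lookup : ∀ {n} (I J K : Subset n) i → lookup (I ∩ J ∩ K) i ≡ lookup I i ∧ᵇ (lookup J i ∧ᵇ lookup K i)
∩₃-lookup I J K i = trans (Vec.lookup-zipWith _∧ᵇ_ i I (J ∩ K)) (cong (lookup I i ∧ᵇ_) (Vec.lookup-zipWith _∧ᵇ_ i J K))

module _ {n} {σ : Permutation′ n} (involutive : ∀ i → σ ⟨$⟩ʳ (σ ⟨$⟩ʳ i) ≡ i) where

  inverse≡ : ∀ i → σ ⟨$⟩ˡ i ≡ σ ⟨$⟩ʳ i
  inverse≡ i = trans (cong (σ ⟨$⟩ˡ_) (sym (involutive i))) (inverseˡ σ)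

  lookup-image : ∀ I i → lookup (image σ I) i ≡ lookup I (σ ⟨$⟩ʳ i)
  lookup-image I i = trans (Vec.lookup∘tabulate _ i) (cong (lookup I) (inverse≡ i))

  -- The entry at (0,1) is the one that `symmetric` dictates from (1,0).
  pattern′ : (I₁ I₂ I₃ : Subset n) → Four → Fin n → Bool
  pattern′ I₁ I₂ I₃ (1ᵇ , 0ᵇ) i = lookup I₁ i
  pattern′ I₁ I₂ I₃ (0ᵇ , 1ᵇ) i = lookup I₁ (σ ⟨$⟩ʳ i)
  pattern′ I₁ I₂ I₃ (1ᵇ , 1ᵇ) i = lookup I₂ i
  pattern′ I₁ I₂ I₃ (0ᵇ , 0ᵇ) i = lookup I₃ i

  -- `fixes-I₂` and `fixes-I₃` are the symmetry at the two values fixed by `swap`. Were all four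
  -- values excluded at `i`, both `i` and `σ i` would lie in the triple intersection, against
  -- `disjoint`.
  consistent⇒pattern : ∀ {I₁ I₂ I₃} → Consistent σ I₁ I₂ I₃ → Pattern σ (pattern′ I₁ I₂ I₃)
  consistent⇒pattern {I₁} {I₂} {I₃} consistent = record
    { symmetric = λ
      { (1ᵇ , 0ᵇ) i → cong (lookup I₁) (involutive i)
      ; (0ᵇ , 1ᵇ) i → refl
      ; (1ᵇ , 1ᵇ) i → fixed I₂ fixes-I₂ i
      ; (0ᵇ , 0ᵇ) i → fixed I₃ fixes-I₃ i
      }
    ; inhabited = inhabited
    }
    where
    open Consistent consistent
    fixed : ∀ I → image σ I ≡ I → ∀ i → lookup I (σ ⟨$⟩ʳ i) ≡ lookup I i
    fixed I h i = trans (sym (lookup-image I i)) (cong (λ J → lookup J i) h)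

    J = I₁ ∩ I₂ ∩ I₃

    inhabited : ∀ i → ∃ λ g → pattern′ I₁ I₂ I₃ g i ≡ 0ᵇ
    inhabited i with lookup I₁ i in p₁ | lookup I₁ (σ ⟨$⟩ʳ i) in p₂ | lookup I₂ i in p₃ | lookup I₃ i in p₄
    ... | 0ᵇ | _  | _  | _  = (1ᵇ , 0ᵇ) , p₁
    ... | 1ᵇ | 0ᵇ | _  | _  = (0ᵇ , 1ᵇ) , p₂
    ... | 1ᵇ | 1ᵇ | 0ᵇ | _  = (1ᵇ , 1ᵇ) , p₃
    ... | 1ᵇ | 1ᵇ | 1ᵇ | 0ᵇ = (0ᵇ , 0ᵇ) , p₄
    ... | 1ᵇ | 1ᵇ | 1ᵇ | 1ᵇ = ⊥-elim (disjoint (i , Vec.lookup⇒[]= i _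
      (trans (Vec.lookup-zipWith _∧ᵇ_ i J (image σ J)) (cong₂ _∧ᵇ_
        (trans (∩₃-lookup I₁ I₂ I₃ i) (cong₂ _∧ᵇ_ p₁ (cong₂ _∧ᵇ_ p₃ p₄)))
        (trans (lookup-image J i) (trans (∩₃-lookup I₁ I₂ I₃ (σ ⟨$⟩ʳ i)) (cong₂ _∧ᵇ_ p₂
          (cong₂ _∧ᵇ_ (trans (fixed I₂ fixes-I₂ i) p₃) (trans (fixed I₃ fixes-I₃ i) p₄)))))))))

module _ {ℓ : Level} (B : FilterBase ℓ) (proper : ∀ k → ∃ λ p → FilterBase.Holds B k p) where
  open LocalFunctions B

  isECDA : IsModel structure ECDA
  isECDA φ (complementedDeMorgan ax) = isComplementedDeMorgan proper φ ax
  isECDA _ (extension _ σ involutive I₁ I₂ I₃ consistent) =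
    Semantics.closure-intro structure ((⋀ λ i → var i ≠ 𝟎) ∧ equations σ ⇒ ex (φ̃ I₁ I₂ I₃)) λ ys (nonzero , eqs) →
      let x , reflects = Extension.realizes σ _ (consistent⇒pattern involutive consistent) ys
            (E.ev-map (equations⇒partition σ _)
              (Equivalence.to (Representation.equational representation (equations-equational σ) ys) eqs))
            (λ i h → case Semantics.⋀-elim structure (λ i → var i ≠ 𝟎) nonzero i h of λ ())
      in x , Equivalence.from
           (Complemented.φ̃⟺ (isComplementedDeMorgan proper) representation I₁ I₂ I₃ x ys)
           λ i → reflects (1ᵇ , 0ᵇ) i , reflects (1ᵇ , 1ᵇ) i , reflects (0ᵇ , 0ᵇ) i

-- Amalgamation

module DeMorganAlgebra {ℓ : Level} {M : Structure ℓ} (isModel : IsModel M DeMorgan) where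
  open Structure M public
  private module ≈ = IsEquivalence isEquivalence

  lattice : Lattice ℓ ℓ
  lattice = record
    { Carrier   = Carrier
    ; _≈_       = _≈_
    ; _∨_       = plus
    ; _∧_       = times
    ; isLattice = record
      { isEquivalence = isEquivalence
      -- `closure` quantifies the last variable outermost, so the arguments come in the order z, y,
      -- x, with a dummy for an absent variable.
      ; ∨-comm        = λ x y → isModel _ +-comm x y x
      ; ∨-assoc       = λ x y z → isModel _ +-assoc z y x
      ; ∨-cong        = plus-cong
      ; ∧-comm        = λ x y → isModel _ ·-comm x y x
      ; ∧-assoc       = λ x y z → isModel _ ·-assoc z y x
      ; ∧-cong        = times-cong
      ; absorptive    = (λ x y → isModel _ +-absorbs-· x y x) , (λ x y → isModel _ ·-absorbs-+ x y x)
      }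
    }

  open LatticeProperties lattice using (poset; ∨-∧-isOrderTheoreticLattice)
  open IsOrderLattice ∨-∧-isOrderTheoreticLattice public
    using (x≤x∨y; y≤x∨y; ∨-least; x∧y≤x; x∧y≤y; ∧-greatest; antisym)
    renaming (refl to ≤-refl; trans to ≤-trans; reflexive to ≤-reflexive)
  open Poset poset public using () renaming (_≤_ to _⊑_)

  ⊑-one : ∀ a → a ⊑ oneᴰ
  ⊑-one a = ≈.sym (isModel _ ·-one a a a)

  zero-⊑ : ∀ a → zeroᴰ ⊑ a
  zero-⊑ a = ≤-trans (y≤x∨y a zeroᴰ) (≤-reflexive (isModel _ +-zero a a a))

  bar-bar : ∀ a → bar (bar a) ≈ a
  bar-bar a = isModel _ bar-invol a a a

  bar-+ : ∀ a b → bar (plus a b) ≈ times (bar a) (bar b)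
  bar-+ a b = isModel _ bar-plus a b a

  bar-· : ∀ a b → bar (times a b) ≈ plus (bar a) (bar b)
  bar-· a b = ≈.trans (bar-cong (≈.sym (≈.trans (bar-+ (bar a) (bar b)) (times-cong (bar-bar a) (bar-bar b)))))
                      (bar-bar (plus (bar a) (bar b)))

  one≈bar-zero : oneᴰ ≈ bar zeroᴰ
  one≈bar-zero = antisym
    (≤-trans (≤-reflexive (≈.trans (≈.sym (bar-bar oneᴰ))
        (≈.trans (bar-cong (≈.sym (isModel _ +-zero oneᴰ oneᴰ (bar oneᴰ)))) (bar-+ (bar oneᴰ) zeroᴰ))))
      (x∧y≤y _ _))
    (⊑-one _)

  bar-one≈zero : bar oneᴰ ≈ zeroᴰ
  bar-one≈zero = ≈.trans (bar-cong one≈bar-zero) (bar-bar zeroᴰ)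

  -- By distributivity `u` is the join of its meets with `w` and `a`. Read contrapositively, a pair
  -- u ⋢ w survives either meeting `u` with `a` or joining `a` to `w`.
  cut : ∀ {u w a} → times u a ⊑ w → u ⊑ plus w a → u ⊑ w
  cut {u} {w} {a} p q = ≤-trans (∧-greatest ≤-refl q)
    (≤-trans (≤-reflexive (isModel _ ·-distrib-+ a w u)) (∨-least (x∧y≤y u w) p))

  one⋢zero : ¬ oneᴰ ⊑ zeroᴰ
  one⋢zero h = case isModel _ zero≠one (antisym (zero-⊑ _) h) of λ ()

-- A split stands for the prime filters containing lo and missing hi.  One
-- that decides given finitely many elements exists without choice, and val p
-- respects the operations on the elements that p decides.
module Splits (em : ∀ {a} → ExcludedMiddle a) {ℓ : Level} {M : Structure ℓ} (isModel : IsModel M DeMorgan) where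
  open DeMorganAlgebra isModel public
  private module ≈ = IsEquivalence isEquivalence

  record Split : Set ℓ where
    field
      lo hi : Carrier
      split : ¬ lo ⊑ hi

  open Split public

  Decides : Split → Carrier → Set ℓ
  Decides p a = lo p ⊑ a ⊎ a ⊑ hi p

  Refines : Split → Carrier → Carrier → Set ℓ
  Refines p u w = lo p ⊑ u × w ⊑ hi p

  -- The prime filter argument for finitely many elements: each `a` in turn goes below `hi` if its
  -- meet with `u` lies below `w`, and above `lo` otherwise.
  sharpen : ∀ as {u w} → ¬ u ⊑ w → ∃ λ p → All (Decides p) as × Refines p u w
  sharpen []       u⋢w = record { split = u⋢w } , [] , ≤-refl , ≤-refl
  sharpen (a ∷ as) {u} {w} u⋢w with em {P = times u a ⊑ w}
  ... | no ua⋢w =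
    let p , ds , lo≤ , ≤hi = sharpen as ua⋢w
    in p , inj₁ (≤-trans lo≤ (x∧y≤y u a)) ∷ ds , ≤-trans lo≤ (x∧y≤x u a) , ≤hi
  ... | yes ua⊑w =
    let p , ds , lo≤ , ≤hi = sharpen as (λ u⊑wa → u⋢w (cut ua⊑w u⊑wa))
    in p , inj₂ (≤-trans (y≤x∨y w a) ≤hi) ∷ ds , lo≤ , ≤-trans (x≤x∨y w a) ≤hi

  _⊑ᵇ_ : Carrier → Carrier → Bool
  u ⊑ᵇ a = does (em {P = u ⊑ a})

  ⊑⇒⊑ᵇ : ∀ {u a} → u ⊑ a → u ⊑ᵇ a ≡ 1ᵇ
  ⊑⇒⊑ᵇ = dec-true em

  ⊑ᵇ⇒⊑ : ∀ {u a} → u ⊑ᵇ a ≡ 1ᵇ → u ⊑ a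
  ⊑ᵇ⇒⊑ {u} {a} h with em {P = u ⊑ a}
  ... | yes u⊑a = u⊑a

  ⊑ᵇ-cong : ∀ {u a b} → a ≈ b → u ⊑ᵇ a ≡ u ⊑ᵇ b
  ⊑ᵇ-cong a≈b = does-⇔ (mk⇔ (λ h → ≤-trans h (≤-reflexive a≈b)) (λ h → ≤-trans h (≤-reflexive (≈.sym a≈b)))) em em

  ⊑ᵇ-times : ∀ u a b → u ⊑ᵇ times a b ≡ u ⊑ᵇ a ∧ᵇ u ⊑ᵇ b
  ⊑ᵇ-times u a b = does-⇔
    (mk⇔ (λ h → ≤-trans h (x∧y≤x a b) , ≤-trans h (x∧y≤y a b)) (uncurry ∧-greatest)) em (em ×-dec em)

  ⊑ᵇ-plus : ∀ p {a b} → Decides p a → Decides p b → lo p ⊑ᵇ plus a b ≡ lo p ⊑ᵇ a ∨ᵇ lo p ⊑ᵇ b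
  ⊑ᵇ-plus p {a} {b} da db = does-⇔
    (mk⇔ (prime da db) Sum.[ (λ h → ≤-trans h (x≤x∨y a b)) , (λ h → ≤-trans h (y≤x∨y a b)) ]) em (em ⊎-dec em)
    where
    prime : Decides p a → Decides p b → lo p ⊑ plus a b → lo p ⊑ a ⊎ lo p ⊑ b
    prime (inj₁ h) _        _ = inj₁ h
    prime _        (inj₁ h) _ = inj₂ h
    prime (inj₂ h) (inj₂ k) l = contradiction (≤-trans l (∨-least h k)) (split p)

  -- The second component is membership in the image of the prime filter under its involution, the
  -- set of all `a` whose bar is outside the filter.
  val : Split → Carrier → Four
  val p a = lo p ⊑ᵇ a , not (lo p ⊑ᵇ bar a)

  val-cong : ∀ {a b} → a ≈ b → ∀ p → val p a ≡ val p b
  val-cong a≈b p = cong₂ _,_ (⊑ᵇ-cong a≈b) (cong not (⊑ᵇ-cong (bar-cong a≈b)))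

  -- For a pair a ⋢ b the hypothesis gives a split with `lo p` below `a` and `b` below `hi p`; equal
  -- values put `lo p` below `b`, hence below `hi p`.
  separate : ∀ {a b} → (∀ {u w} → ¬ u ⊑ w → ∃ λ p → Refines p u w × val p a ≡ val p b) → a ≈ b
  separate h = antisym (below h) (below λ u⋢w → let p , r , e = h u⋢w in p , r , sym e)
    where
    below : ∀ {a b} → (∀ {u w} → ¬ u ⊑ w → ∃ λ p → Refines p u w × val p a ≡ val p b) → a ⊑ b
    below {a} {b} h = decidable-stable em λ a⋢b →
      let p , (lo≤a , b≤hi) , e = h a⋢b
      in split p (≤-trans (⊑ᵇ⇒⊑ (trans (sym (cong proj₁ e)) (⊑⇒⊑ᵇ lo≤a))) b≤hi)

  base : FilterBase ℓ
  base = record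
    { Point    = Split
    ; Stage    = List Carrier
    ; Holds    = λ as p → All (Decides p) as
    ; ⊤ˢ       = []
    ; _⊓ˢ_     = _++_
    ; ⊓ˢ-holds = λ as bs → All.++⁻ as {bs}
    }

  proper : ∀ as → ∃ λ p → FilterBase.Holds base as p
  proper as = let p , ds , _ = sharpen as {oneᴰ} {zeroᴰ} one⋢zero in p , ds

  representation : Representation M
  representation = record
    { base       = base
    ; val        = val
    ; val-cong   = λ a≈b → always (val-cong a≈b)
    ; separating = λ (as , h) → separate λ u⋢w →
        let p , ds , r = sharpen as u⋢w in p , r , h {p} ds
    ; val-plus   = λ a b → (a ∷ b ∷ []) , λ { {p} (da ∷ db ∷ []) → cong₂ _,_
        (⊑ᵇ-plus p da db)
        (trans (cong not (trans (⊑ᵇ-cong (bar-+ a b)) (⊑ᵇ-times (lo p) (bar a) (bar b))))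
               (BoolAlgebra.deMorgan₁ (lo p ⊑ᵇ bar a) (lo p ⊑ᵇ bar b))) }
    -- Meets need no primeness, but in the second component they become joins of bars, so the bars
    -- must be decided. For `val-plus` the roles are exchanged.
    ; val-times  = λ a b → (bar a ∷ bar b ∷ []) , λ { {p} (da ∷ db ∷ []) → cong₂ _,_
        (⊑ᵇ-times (lo p) a b)
        (trans (cong not (trans (⊑ᵇ-cong (bar-· a b)) (⊑ᵇ-plus p da db)))
               (BoolAlgebra.deMorgan₂ (lo p ⊑ᵇ bar a) (lo p ⊑ᵇ bar b))) }
    ; val-bar    = λ a → always λ p → cong₂ _,_ (sym (Bool.not-involutive (lo p ⊑ᵇ bar a))) (cong not (⊑ᵇ-cong (bar-bar a)))
    ; val-zero   = always λ p → cong₂ _,_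
        (dec-false em (lo⋢zero p))
        (cong not (⊑⇒⊑ᵇ (≤-trans (⊑-one _) (≤-reflexive one≈bar-zero))))
    ; val-one    = always λ p → cong₂ _,_
        (⊑⇒⊑ᵇ (⊑-one _))
        (cong not (dec-false em λ h → lo⋢zero p (≤-trans h (≤-reflexive bar-one≈zero))))
    }
    where
    open FilterBase base using (always)
    lo⋢zero : ∀ p → ¬ lo p ⊑ zeroᴰ
    lo⋢zero p h = split p (≤-trans h (zero-⊑ _))

-- Agreeing splits over a common subalgebra

module EmbeddingProperties {ℓ : Level} {M N : Structure ℓ} (isModelM : IsModel M DeMorgan)
                           (isModelN : IsModel N DeMorgan) (f : Embedding M N) where
  private
    module M = DeMorganAlgebra isModelM
    module N = DeMorganAlgebra isModelN
    module ≈ = IsEquivalence N.isEquivalence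
  open Embedding f using (map; injective; times-homo) renaming (cong to map-cong)

  -- The order `a ⊑ b` unfolds to the equation `a ≈ times a b`, which embeddings preserve and
  -- reflect.
  map-mono : ∀ {a b} → a M.⊑ b → map a N.⊑ map b
  map-mono a⊑b = ≈.trans (map-cong a⊑b) (times-homo _ _)

  map-reflects : ∀ {a b} → map a N.⊑ map b → a M.⊑ b
  map-reflects h = injective (≈.trans h (≈.sym (times-homo _ _)))

module Transfer (em : ∀ {a} → ExcludedMiddle a) {ℓ : Level} {M₀ M₁ M₂ : Structure ℓ}
                (isModel₀ : IsModel M₀ DeMorgan) (isModel₁ : IsModel M₁ DeMorgan) (isModel₂ : IsModel M₂ DeMorgan)
                (f₁ : Embedding M₀ M₁) (f₂ : Embedding M₀ M₂) where
  private
    module S₁ = Splits em isModel₁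
    module S₂ = Splits em isModel₂
    module M₀ = DeMorganAlgebra isModel₀
    module f₁ = Embedding f₁
    module f₂ = Embedding f₂
    module ≈₁ = IsEquivalence S₁.isEquivalence
    open EmbeddingProperties isModel₀ isModel₁ f₁ using () renaming (map-mono to mono₁)
    open EmbeddingProperties isModel₀ isModel₂ f₂ using () renaming (map-mono to mono₂; map-reflects to reflects₂)

  Agree : S₁.Split → S₂.Split → M₀.Carrier → Set
  Agree p q c = S₁.val p (f₁.map c) ≡ S₂.val q (f₂.map c)

  -- The pair u ⋢ w decides cs in M₀ as p does, so any split of M₂ refining the
  -- image of this pair agrees with p.
  interpolant : ∀ p cs → All (λ c → S₁.Decides p (f₁.map c)) cs →
    ∃[ u ] ∃[ w ] S₁.lo p S₁.⊑ f₁.map u × f₁.map w S₁.⊑ S₁.hi p ×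
    All (λ c → (u M₀.⊑ c × S₁.lo p S₁.⊑ f₁.map c) ⊎ (c M₀.⊑ w × f₁.map c S₁.⊑ S₁.hi p)) cs
  interpolant p [] [] = M₀.oneᴰ , M₀.zeroᴰ
    , S₁.≤-trans (S₁.⊑-one _) (S₁.≤-reflexive (≈₁.sym f₁.one-homo))
    , S₁.≤-trans (S₁.≤-reflexive f₁.zero-homo) (S₁.zero-⊑ _)
    , []
  interpolant p (c ∷ cs) (d ∷ ds) with interpolant p cs ds
  ... | u , w , ≤u , w≤ , sides with d
  ...   | inj₁ lo≤c = M₀.times u c , w
    , S₁.≤-trans (S₁.∧-greatest ≤u lo≤c) (S₁.≤-reflexive (≈₁.sym (f₁.times-homo u c)))
    , w≤
    , inj₁ (M₀.x∧y≤y u c , lo≤c)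
      ∷ All.map (Sum.map₁ λ (u≤ , l) → M₀.≤-trans (M₀.x∧y≤x u c) u≤ , l) sides
  ...   | inj₂ c≤hi = u , M₀.plus w c
    , ≤u
    , S₁.≤-trans (S₁.≤-reflexive (f₁.plus-homo w c)) (S₁.∨-least w≤ c≤hi)
    , inj₂ (M₀.y≤x∨y w c , c≤hi)
      ∷ All.map (Sum.map₂ λ (≤w , l) → M₀.≤-trans ≤w (M₀.x≤x∨y w c) , l) sides

  -- A decision about `cs` in `M₁` is pulled back to a pair in `M₀` and pushed on to `M₂`. That `p`
  -- refines a given pair yields the injectivity of `g₁` and `g₂`.
  transfer : ∀ as bs cs {u w} → ¬ u S₁.⊑ w → ∃[ p ] ∃[ q ]
    All (S₁.Decides p) as × All (S₂.Decides q) bs × All (Agree p q) cs × S₁.Refines p u w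
  transfer as bs cs u⋢w =
    -- The bars are included because the second component of `val` asks about them.
    let ds = cs ++ List.map M₀.bar cs
        p , decides , refines = S₁.sharpen (as ++ List.map f₁.map ds) u⋢w
        decides-as , decides-ds = All.++⁻ as decides
        u₀ , w₀ , ≤u₀ , w₀≤ , sides = interpolant p ds (All.map⁻ decides-ds)
        -- If the pair collapsed in `M₂` it would collapse in `M₀`, and then its image in `M₁` would
        -- put `lo p` below `hi p`.
        u₀⋢w₀ = λ h → S₁.split p (S₁.≤-trans ≤u₀ (S₁.≤-trans (mono₁ (reflects₂ h)) w₀≤))
        q , decides-bs , ≤f₂u₀ , f₂w₀≤ = S₂.sharpen bs u₀⋢w₀
        same = All.map (sameSide p q ≤f₂u₀ f₂w₀≤) sides
        same-cs , same-bars = All.++⁻ cs same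
    in p , q , decides-as , decides-bs
     , All.zipWith (λ (s , t) → cong₂ _,_ s (cong not
         (trans (S₁.⊑ᵇ-cong (≈₁.sym (f₁.bar-homo _))) (trans t (S₂.⊑ᵇ-cong (f₂.bar-homo _))))))
         (same-cs , All.map⁻ same-bars)
     , refines
    where
    sameSide : ∀ p q {u w} → S₂.lo q S₂.⊑ f₂.map u → f₂.map w S₂.⊑ S₂.hi q → ∀ {c} →
      (u M₀.⊑ c × S₁.lo p S₁.⊑ f₁.map c) ⊎ (c M₀.⊑ w × f₁.map c S₁.⊑ S₁.hi p) →
      S₁.lo p S₁.⊑ᵇ f₁.map c ≡ S₂.lo q S₂.⊑ᵇ f₂.map c
    sameSide p q ≤u w≤ (inj₁ (u≤c , lo≤c)) =
      trans (S₁.⊑⇒⊑ᵇ lo≤c) (sym (S₂.⊑⇒⊑ᵇ (S₂.≤-trans ≤u (mono₂ u≤c))))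
    sameSide p q ≤u w≤ (inj₂ (c≤w , c≤hi)) = trans
      (dec-false em λ lo≤c → S₁.split p (S₁.≤-trans lo≤c c≤hi))
      (sym (dec-false em λ lo≤c → S₂.split q (S₂.≤-trans lo≤c (S₂.≤-trans (mono₂ c≤w) w≤))))

module Amalgam (em : ∀ {a} → ExcludedMiddle a) {ℓ : Level} {M₀ M₁ M₂ : Structure ℓ}
               (isModel₀ : IsModel M₀ DeMorgan) (isModel₁ : IsModel M₁ DeMorgan) (isModel₂ : IsModel M₂ DeMorgan)
               (f₁ : Embedding M₀ M₁) (f₂ : Embedding M₀ M₂) where
  private
    module S₁ = Splits em isModel₁
    module S₂ = Splits em isModel₂
    module R₁ = Representation S₁.representation
    module R₂ = Representation S₂.representation
    module T₁ = Transfer em isModel₀ isModel₁ isModel₂ f₁ f₂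
    module T₂ = Transfer em isModel₀ isModel₂ isModel₁ f₂ f₁

  amalgamBase : FilterBase ℓ
  amalgamBase = record
    { Point    = S₁.Split × S₂.Split
    ; Stage    = List S₁.Carrier × List S₂.Carrier × List (Structure.Carrier M₀)
    ; Holds    = λ (as , bs , cs) (p , q) → Lift ℓ
        (All (S₁.Decides p) as × All (S₂.Decides q) bs × All (T₁.Agree p q) cs)
    ; ⊤ˢ       = [] , [] , []
    ; _⊓ˢ_     = λ (as , bs , cs) (as′ , bs′ , cs′) → as ++ as′ , bs ++ bs′ , cs ++ cs′
    ; ⊓ˢ-holds = λ (as , bs , cs) _ (lift (ds , es , fs)) →
        let d , d′ = All.++⁻ as ds ; e , e′ = All.++⁻ bs es ; f , f′ = All.++⁻ cs fs
        in lift (d , e , f) , lift (d′ , e′ , f′)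
    }

  proper : ∀ k → ∃ λ p → FilterBase.Holds amalgamBase k p
  proper (as , bs , cs) =
    let p , q , d , e , f , _ = T₁.transfer as bs cs S₁.one⋢zero in (p , q) , lift (d , e , f)

  open LocalFunctions amalgamBase

  private
    pointwise : (S₁.Split × S₂.Split → Four) → LocalFunction
    pointwise v = record { at = λ p _ → v p ; bound = 0 ; local = λ _ _ → refl }

    from₁ : ∀ {q} {Q : S₁.Split → Set q} → R₁.Eventually Q → E.Eventually λ ((p , _) , _) → Q p
    from₁ (as , h) = (as , [] , []) , λ (lift (d , _)) → h d

    from₂ : ∀ {q} {Q : S₂.Split → Set q} → R₂.Eventually Q → E.Eventually λ ((_ , p) , _) → Q p
    from₂ (bs , h) = ([] , bs , []) , λ (lift (_ , e , _)) → h e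

  g₁ : Embedding M₁ structure
  g₁ = record
    { map        = λ a → pointwise λ (p , _) → S₁.val p a
    ; cong       = from₁ ∘ R₁.val-cong
    ; injective  = λ ((as , bs , cs) , h) → S₁.separate λ u⋢w →
        let p , q , d , e , f , r = T₁.transfer as bs cs u⋢w
        in p , r , h {(p , q) , λ _ → 𝟜.zeroᴰ} (lift (d , e , f))
    ; plus-homo  = λ a b → from₁ (R₁.val-plus a b)
    ; times-homo = λ a b → from₁ (R₁.val-times a b)
    ; bar-homo   = λ a → from₁ (R₁.val-bar a)
    ; zero-homo  = from₁ R₁.val-zero
    ; one-homo   = from₁ R₁.val-one
    }

  g₂ : Embedding M₂ structure
  g₂ = record
    { map        = λ a → pointwise λ (_ , p) → S₂.val p a
    ; cong       = from₂ ∘ R₂.val-cong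
    ; injective  = λ ((as , bs , cs) , h) → S₂.separate λ u⋢w →
        let q , p , e , d , f , r = T₂.transfer bs as cs u⋢w
        in q , r , h {(p , q) , λ _ → 𝟜.zeroᴰ} (lift (d , e , All.map sym f))
    ; plus-homo  = λ a b → from₂ (R₂.val-plus a b)
    ; times-homo = λ a b → from₂ (R₂.val-times a b)
    ; bar-homo   = λ a → from₂ (R₂.val-bar a)
    ; zero-homo  = from₂ R₂.val-zero
    ; one-homo   = from₂ R₂.val-one
    }

  amalgamate : Σ[ M ∈ Structure ℓ ] IsModel M ECDA × Σ[ h₁ ∈ Embedding M₁ M ] Σ[ h₂ ∈ Embedding M₂ M ]
    (∀ c → Structure._≈_ M (Embedding.map h₁ (Embedding.map f₁ c)) (Embedding.map h₂ (Embedding.map f₂ c)))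
  amalgamate = structure , isECDA amalgamBase proper , g₁ , g₂ ,
    λ c → ([] , [] , c ∷ []) , λ { (lift (_ , _ , agree ∷ _)) → agree }

open Amalgam using (amalgamate)

-- Back and forth

record Enumeration {a p} {A : Set a} (P : A → Set p) (xs : List A) : Set (a ⊔ p) where
  field
    size      : ℕ
    enum      : Fin size → A
    injective : ∀ {i j} → enum i ≡ enum j → i ≡ j
    sound     : ∀ i → P (enum i)
    complete  : ∀ {x} → x ∈ xs → P x → ∃ λ i → enum i ≡ x

-- Excluded middle decides both `P x` and whether `x` has occurred before. Repetitions are dropped
-- because cells with different indices must be disjoint.
enumeration : (∀ {a} → ExcludedMiddle a) → ∀ {a p} {A : Set a} (P : A → Set p) xs → Enumeration P xs
enumeration em P [] = record { size = 0 ; enum = λ () ; injective = λ { {()} } ; sound = λ () ; complete = λ () }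
enumeration em P (x ∷ xs) with enumeration em P xs
... | en with em {P = P x} | em {P = ∃ λ i → Enumeration.enum en i ≡ x}
...   | no ¬px | _ = record { Enumeration en ; complete = λ
  { (here refl) px → contradiction px ¬px ; (there i) → Enumeration.complete en i } }
...   | yes _ | yes old = record { Enumeration en ; complete = λ
  { (here refl) _ → old ; (there i) → Enumeration.complete en i } }
...   | yes px | no new = record
  { size      = suc size
  ; enum      = λ { zero → x ; (suc i) → enum i }
  ; injective = λ
    { {zero}  {zero}  _ → refl
    ; {zero}  {suc j} e → contradiction (j , sym e) new
    ; {suc i} {zero}  e → contradiction (i , e) new
    ; {suc i} {suc j} e → cong suc (injective e)
    }
  ; sound     = λ { zero → px ; (suc i) → sound i }
  ; complete  = λ
    { (here refl) _ → zero , refl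
    ; (there x∈) px → let i , e = complete x∈ px in suc i , e
    }
  }
  where
  open Enumeration en

-- Types of tuples

inds-nonzero : ∀ {n} (e : Vec Four n) → ¬ inds e e ≡ 𝟜.zeroᴰ
inds-nonzero e h = 1ᵇ≢0ᵇ (trans (sym (inds-refl e)) (cong proj₁ h))

module Types {ℓ : Level} {M : Structure ℓ} (rep : Representation M) where
  open Structure M
  open Representation rep

  avoids-cons : ∀ {n} {e : Vec Four n} {ρ} g x → Avoids e ρ → Avoids (g ∷ e) (x ∷ ρ)
  avoids-cons g x = ev-map λ {p} → cong (λ h → 𝟜.times h (ind g (val p x)))

  -- At each point `x` has one of four values, so some extension of `e` takes over its cell there.
  -- The second component is handled by the swapped value.
  avoids-uncons : ∀ {n} {e : Vec Four n} {ρ} x → (∀ g → Avoids (g ∷ e) (x ∷ ρ)) → Avoids e ρ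
  avoids-uncons {e = e} {ρ} x h = ev-map (λ {p} hs → ≡zero
      (λ q → let g = val p x in
        1ᵇ≢0ᵇ (trans (sym (cong₂ _∧ᵇ_ q (ind-refl g))) (cong proj₁ (hs (∈-fours g)))))
      (λ q → let g = val p x in
        1ᵇ≢0ᵇ (trans (sym (cong₂ _∧ᵇ_ q (ind-refl g))) (cong proj₂ (hs (∈-fours (swap g)))))))
    (ev-∀∈ {Q = λ g p → inds (g ∷ e) (vals p (x ∷ ρ)) ≡ 𝟜.zeroᴰ} fours h)

  avoids-swaps : ∀ {n} (e : Vec Four n) {ρ} → Avoids e ρ → Avoids (swaps e) ρ
  avoids-swaps e = ev-map λ h → trans (inds-swaps e _) (cong swap h)

  avoids-swaps⟺ : ∀ {n} (e : Vec Four n) ρ → Avoids e ρ ⟺ Avoids (swaps e) ρ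
  avoids-swaps⟺ e ρ = mk⇔ (avoids-swaps e)
    (subst (λ e → Avoids e ρ) (swaps-involutive e) ∘ avoids-swaps (swaps e))

  -- A point never avoids its own value. If all values were avoided, some stage would hold at no
  -- point, and then 0 ≈ 1 by `separating`.
  some-unavoided : ¬ zeroᴰ ≈ oneᴰ → ∀ {n} (ρ : Vec Carrier n) → ¬ (∀ e → Avoids e ρ)
  some-unavoided 0≉1 ρ h = 0≉1 (separating (ev-map
    (λ {p} hs → ⊥-elim (inds-nonzero (vals p ρ) (hs (∈-allVecs (vals p ρ))))) (ev-∀∈ (allVecs _) h)))

  -- `inds e f` is nonzero only for `f` equal to `e` or `swaps e`, and an equation has the same
  -- truth value at both. Thus the avoided values determine all equations.
  equation⟺ : ∀ {n} (s t : Term n) ρ →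
    Satisfies M ρ (s ≐ t) ⟺ (∀ e → ⟦_⟧ 𝟜 s e ≢ ⟦_⟧ 𝟜 t e → Avoids e ρ)
  equation⟺ s t ρ = mk⇔
    (λ h e s≢t → ev-map (avoided e s≢t) (Equivalence.to (equational (s ≐ t) ρ) h))
    (λ h → Equivalence.from (equational (s ≐ t) ρ) (ev-map
      (λ {p} hs → decidable-stable (_ ≟⁴ _) λ s≢t → inds-nonzero (vals p ρ) (hs (∈-allVecs (vals p ρ)) s≢t))
      (ev-∀∈ (allVecs _) λ e → unless e (h e))))
    where
    avoided : ∀ e {f} → ⟦_⟧ 𝟜 s e ≢ ⟦_⟧ 𝟜 t e → ⟦_⟧ 𝟜 s f ≡ ⟦_⟧ 𝟜 t f → inds e f ≡ 𝟜.zeroᴰ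
    avoided e {f} s≢t s≡t = ≡zero
      (λ h → s≢t (subst (λ f → ⟦_⟧ 𝟜 s f ≡ ⟦_⟧ 𝟜 t f) (sym (inds-sound₁ e f h)) s≡t))
      (λ h → s≢t (cong swap (trans (sym (term-swaps s e)) (trans
        (subst (λ f → ⟦_⟧ 𝟜 s f ≡ ⟦_⟧ 𝟜 t f) (sym (inds-sound₂ e f h)) s≡t) (term-swaps t e)))))
    -- `Eventually` must name its stage before the premise is available, so the premise is decided
    -- first.
    unless : ∀ e → (⟦_⟧ 𝟜 s e ≢ ⟦_⟧ 𝟜 t e → Avoids e ρ) →
      Eventually λ p → ⟦_⟧ 𝟜 s e ≢ ⟦_⟧ 𝟜 t e → inds e (vals p ρ) ≡ 𝟜.zeroᴰ
    unless e h with ⟦_⟧ 𝟜 s e ≟⁴ ⟦_⟧ 𝟜 t e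
    ... | yes s≡t = always λ _ s≢t → contradiction s≡t s≢t
    ... | no  s≢t = ev-map const (h s≢t)

SameType : ∀ {ℓ n} {M N : Structure ℓ} (rM : Representation M) (rN : Representation N) →
  Vec (Structure.Carrier M) n → Vec (Structure.Carrier N) n → Set ℓ
SameType rM rN ρ ρ′ = ∀ e → Representation.Avoids rM e ρ ⟺ Representation.Avoids rN e ρ′

module BackAndForth (em : ∀ {a} → ExcludedMiddle a) {ℓ : Level} {M N : Structure ℓ}
    (rM : Representation M) (rN : Representation N) (isModel : IsModel N ECDA)
    {n : ℕ} (ρ : Vec (Structure.Carrier M) n) (ρ′ : Vec (Structure.Carrier N) n)
    (same : SameType rM rN ρ ρ′) (c : Structure.Carrier M) where

  private
    module N = Structure N
    module rM = Representation rM
    module rN = Representation rN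
    module tM = Types rM
    module tN = Types rN
    open Complemented (λ φ → isModel φ ∘ complementedDeMorgan) rN

  Realized : Vec Four n → Set ℓ
  Realized e = ¬ rN.Avoids e ρ′

  realized-swaps : ∀ {e} → Realized e → Realized (swaps e)
  realized-swaps {e} h = h ∘ Equivalence.from (tN.avoids-swaps⟺ e ρ′)

  open Enumeration (enumeration em Realized (allVecs n)) renaming (injective to enum-injective)

  -- The involution carries the cell of `e` to the cell of `swaps e`, so it permutes the realized
  -- cells; this is the `σ` of the extension axiom.
  flip : Fin size → Fin size
  flip i = proj₁ (complete (∈-allVecs _) (realized-swaps (sound i)))

  enum-flip : ∀ i → enum (flip i) ≡ swaps (enum i)
  enum-flip i = proj₂ (complete (∈-allVecs _) (realized-swaps (sound i)))

  flip-involutive : ∀ i → flip (flip i) ≡ i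
  flip-involutive i = enum-injective
    (trans (enum-flip (flip i)) (trans (cong swaps (enum-flip i)) (swaps-involutive (enum i))))

  σ : Permutation′ size
  σ = permutation flip flip flip-involutive flip-involutive

  -- The extension axioms start at n = 1; some value is realized because 0 ≠ 1 in `N`.
  1≤size : 1 ≤ size
  1≤size with em {P = ∃ Realized}
  ... | yes (e , r) = inhabited (proj₁ (complete (∈-allVecs e) r))
    where
    inhabited : ∀ {m} → Fin m → 1 ≤ m
    inhabited zero    = s≤s z≤n
    inhabited (suc _) = s≤s z≤n
  ... | no none = contradiction (λ e → decidable-stable em λ r → none (e , r))
    (tN.some-unavoided (λ h → case isModel _ (complementedDeMorgan (deMorgan zero≠one)) h of λ ()) ρ′)

  ys : Vec N.Carrier size
  ys = tabulate λ i → proj₁ (cell (enum i) ρ′)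

  val-ys : ∀ i → rN.Eventually λ p → rN.val p (lookup ys i) ≡ inds (enum i) (rN.vals p ρ′)
  val-ys i = rN.ev-map (λ {p} → trans (cong (rN.val p) (Vec.lookup∘tabulate _ i))) (proj₂ (cell (enum i) ρ′))

  ys-nonzero : ∀ i → ¬ lookup ys i N.≈ N.zeroᴰ
  ys-nonzero i h = sound i (Equivalence.to (rN.zero⟺ (val-ys i)) h)

  -- From a stage on the finitely many avoided values are absent. The value `f` of the tuple at such
  -- a point is then realized, and its cell is the only enumerated one that contains the point.
  ys-partition : rN.Eventually λ p → Partition σ (rN.vals p ys)
  ys-partition = rN.ev-zip (λ {p} → partition p)
    (rN.ev-∀∈ {Q = λ i p → rN.val p (lookup ys i) ≡ inds (enum i) (rN.vals p ρ′)} (List.allFin size) val-ys)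
    (rN.ev-∀∈ {Q = λ e p → rN.Avoids e ρ′ → inds e (rN.vals p ρ′) ≡ 𝟜.zeroᴰ} (allVecs n) avoid)
    where
    avoid : ∀ e → rN.Eventually λ p → rN.Avoids e ρ′ → inds e (rN.vals p ρ′) ≡ 𝟜.zeroᴰ
    avoid e with em {P = rN.Avoids e ρ′}
    ... | yes a = rN.ev-map const a
    ... | no ¬a = rN.always λ _ a → contradiction a ¬a

    partition : ∀ p →
      (∀ {i} → i ∈ List.allFin size → rN.val p (lookup ys i) ≡ inds (enum i) (rN.vals p ρ′)) →
      (∀ {e} → e ∈ allVecs n → rN.Avoids e ρ′ → inds e (rN.vals p ρ′) ≡ 𝟜.zeroᴰ) →
      Partition σ (rN.vals p ys)
    partition p val≡ avoided = record
      { covers   = k , trans (cong proj₁ (at k)) (trans (cong (λ e → proj₁ (inds e f)) enum-k) (inds-refl f))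
      ; disjoint = λ {i} {j} hi hj → enum-injective (trans (hit i hi) (sym (hit j hj)))
      ; swapped  = λ i → trans (at (flip i)) (trans (cong (λ e → inds e f) (enum-flip i))
                     (trans (inds-swaps (enum i) f) (cong swap (sym (at i)))))
      }
      where
      f = rN.vals p ρ′
      at : ∀ i → lookup (rN.vals p ys) i ≡ inds (enum i) f
      at i = trans (Vec.lookup-map i (rN.val p) ys) (val≡ (∈-allFin i))
      hit : ∀ i → proj₁ (lookup (rN.vals p ys) i) ≡ 1ᵇ → enum i ≡ f
      hit i h = inds-sound₁ (enum i) f (trans (sym (cong proj₁ (at i))) h)
      f-enumerated : ∃ λ i → enum i ≡ f
      f-enumerated = complete (∈-allVecs f) λ a → inds-nonzero f (avoided (∈-allVecs f) a)
      k = proj₁ f-enumerated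
      enum-k = proj₂ f-enumerated

  -- The bits record how `c` splits the cells in `M`, indexed by the cells realized in `N`; the
  -- element `d` is to have the same bits there.
  I : Four → Fin size → Bool
  I g i = does (em {P = rM.Avoids (g ∷ enum i) (c ∷ ρ)})

  I-sound : ∀ g i → I g i ≡ 1ᵇ → rM.Avoids (g ∷ enum i) (c ∷ ρ)
  I-sound g i h with em {P = rM.Avoids (g ∷ enum i) (c ∷ ρ)}
  ... | yes a = a

  I-symmetric : ∀ g i → I (swap g) (flip i) ≡ I g i
  I-symmetric g i = trans (cong (λ e → does (em {P = rM.Avoids (swap g ∷ e) (c ∷ ρ)})) (enum-flip i))
    (does-⇔ (sym⟺ (tM.avoids-swaps⟺ (g ∷ enum i) (c ∷ ρ))) em em)

  subset : Four → Subset size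
  subset g = tabulate (I g)

  lookup-subset : ∀ g i → lookup (subset g) i ≡ I g i
  lookup-subset g = Vec.lookup∘tabulate (I g)

  fixed : ∀ g → swap g ≡ g → image σ (subset g) ≡ subset g
  fixed g swap≡ = Vec.tabulate-cong λ i → trans (lookup-subset g (flip i))
    (trans (cong (λ h → I h (flip i)) (sym swap≡)) (I-symmetric g i))

  -- An index violating `disjoint` would make all four extensions of `enum i` by `c` avoided in `M`.
  -- Then `enum i` itself is avoided in `M`, and by `same` in `N`, although it is realized.
  consistent : Consistent σ (subset (1ᵇ , 0ᵇ)) (subset (1ᵇ , 1ᵇ)) (subset (0ᵇ , 0ᵇ))
  consistent = record
    { fixes-I₂ = fixed (1ᵇ , 1ᵇ) refl
    ; fixes-I₃ = fixed (0ᵇ , 0ᵇ) refl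
    ; disjoint = λ (i , i∈) →
        let J = subset (1ᵇ , 0ᵇ) ∩ subset (1ᵇ , 1ᵇ) ∩ subset (0ᵇ , 0ᵇ)
            h , h′ = ∧ᵇ-split (trans (sym (Vec.lookup-zipWith _∧ᵇ_ i J (image σ J))) (Vec.[]=⇒lookup i∈))
            h₁ , h₂ , h₃ = members i h
            h₄ , _ = members (flip i) (trans (sym (Vec.lookup∘tabulate _ i)) h′)
        in sound i (Equivalence.to (same (enum i)) (tM.avoids-uncons c λ
             { (1ᵇ , 0ᵇ) → I-sound (1ᵇ , 0ᵇ) i h₁
             ; (0ᵇ , 1ᵇ) → I-sound (0ᵇ , 1ᵇ) i (trans (sym (I-symmetric (0ᵇ , 1ᵇ) i)) h₄)
             ; (1ᵇ , 1ᵇ) → I-sound (1ᵇ , 1ᵇ) i h₂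
             ; (0ᵇ , 0ᵇ) → I-sound (0ᵇ , 0ᵇ) i h₃
             }))
    }
    where
    members : ∀ i → lookup (subset (1ᵇ , 0ᵇ) ∩ subset (1ᵇ , 1ᵇ) ∩ subset (0ᵇ , 0ᵇ)) i ≡ 1ᵇ →
      I (1ᵇ , 0ᵇ) i ≡ 1ᵇ × I (1ᵇ , 1ᵇ) i ≡ 1ᵇ × I (0ᵇ , 0ᵇ) i ≡ 1ᵇ
    members i h =
      let h₁ , h′ = ∧ᵇ-split (trans (sym (∩₃-lookup (subset (1ᵇ , 0ᵇ)) (subset (1ᵇ , 1ᵇ)) (subset (0ᵇ , 0ᵇ)) i)) h)
          h₂ , h₃ = ∧ᵇ-split h′
      in trans (sym (lookup-subset (1ᵇ , 0ᵇ) i)) h₁ , trans (sym (lookup-subset (1ᵇ , 1ᵇ) i)) h₂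
       , trans (sym (lookup-subset (0ᵇ , 0ᵇ) i)) h₃

  extended : ∃ λ d → Satisfies N (d ∷ ys) (φ̃ (subset (1ᵇ , 0ᵇ)) (subset (1ᵇ , 1ᵇ)) (subset (0ᵇ , 0ᵇ)))
  extended = Semantics.closure-elim N
    ((⋀ λ i → var i ≠ 𝟎) ∧ equations σ ⇒ ex (φ̃ (subset (1ᵇ , 0ᵇ)) (subset (1ᵇ , 1ᵇ)) (subset (0ᵇ , 0ᵇ))))
    (isModel _ (extension 1≤size σ flip-involutive _ _ _ consistent)) ys
    ( Semantics.⋀-intro N (λ i → var i ≠ 𝟎) (λ i h → contradiction h (ys-nonzero i))
    , Equivalence.from (rN.equational (equations-equational σ) ys)
        (rN.ev-map (partition⇒equations σ _) ys-partition))

  d : N.Carrier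
  d = proj₁ extended

  AvoidsAlike : Four → Vec Four n → Set ℓ
  AvoidsAlike g e = rM.Avoids (g ∷ e) (c ∷ ρ) ⟺ rN.Avoids (g ∷ e) (d ∷ ρ′)

  Avoids-disjoint : ∀ g i → rN.Disjoint (lookup ys i) g d ⟺ rN.Avoids (g ∷ enum i) (d ∷ ρ′)
  Avoids-disjoint g i = rN.ev-≡⟺
    (λ p → 𝟜.times (rN.val p (lookup ys i)) (ind g (rN.val p d)))
    (λ p → inds (g ∷ enum i) (rN.vals p (d ∷ ρ′)))
    (rN.ev-map (λ {p} → cong (λ y → 𝟜.times y (ind g (rN.val p d)))) (val-ys i))

  reflects⇒alike : ∀ g i → Reflects (rN.Disjoint (lookup ys i) g d) (lookup (subset g) i) → AvoidsAlike g (enum i)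
  reflects⇒alike g i r = ⟺-trans
    -- One and the same bit `I g i` reflects avoidance in `M` and disjointness in `N`.
    (reflects-unique (proof em) (subst (Reflects (rN.Disjoint (lookup ys i) g d)) (lookup-subset g i) r))
    (Avoids-disjoint g i)

  reflected : ∀ i →
    Reflects (rN.Disjoint (lookup ys i) (1ᵇ , 0ᵇ) d) (lookup (subset (1ᵇ , 0ᵇ)) i) ×
    Reflects (rN.Disjoint (lookup ys i) (1ᵇ , 1ᵇ) d) (lookup (subset (1ᵇ , 1ᵇ)) i) ×
    Reflects (rN.Disjoint (lookup ys i) (0ᵇ , 0ᵇ) d) (lookup (subset (0ᵇ , 0ᵇ)) i)
  reflected = Equivalence.to
    (φ̃⟺ (subset (1ᵇ , 0ᵇ)) (subset (1ᵇ , 1ᵇ)) (subset (0ᵇ , 0ᵇ)) d ys) (proj₂ extended)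

  alike-swaps : ∀ g e → AvoidsAlike (swap g) (swaps e) → AvoidsAlike g e
  alike-swaps g e h = ⟺-trans (tM.avoids-swaps⟺ (g ∷ e) (c ∷ ρ))
    (⟺-trans h (sym⟺ (tN.avoids-swaps⟺ (g ∷ e) (d ∷ ρ′))))

  realized-alike : ∀ g i → AvoidsAlike g (enum i)
  realized-alike (1ᵇ , 0ᵇ) i = reflects⇒alike (1ᵇ , 0ᵇ) i (proj₁ (reflected i))
  realized-alike (1ᵇ , 1ᵇ) i = reflects⇒alike (1ᵇ , 1ᵇ) i (proj₁ (proj₂ (reflected i)))
  realized-alike (0ᵇ , 0ᵇ) i = reflects⇒alike (0ᵇ , 0ᵇ) i (proj₂ (proj₂ (reflected i)))
  -- `φ̃` says nothing directly about (0,1); the involution moves the question to (1,0) on the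
  -- flipped cell.
  realized-alike (0ᵇ , 1ᵇ) i = alike-swaps (0ᵇ , 1ᵇ) (enum i)
    (subst (AvoidsAlike (1ᵇ , 0ᵇ)) (enum-flip i) (realized-alike (1ᵇ , 0ᵇ) (flip i)))

  backAndForth : ∃ λ d → SameType rM rN (c ∷ ρ) (d ∷ ρ′)
  backAndForth = d , sameType
    where
    sameType : SameType rM rN (c ∷ ρ) (d ∷ ρ′)
    sameType (g ∷ e) = case em {P = rN.Avoids e ρ′} of λ
      -- Extensions of an avoided value are avoided on both sides, so only realized cells call for
      -- the axiom.
      { (yes a) → mk⇔ (λ _ → tN.avoids-cons {e = e} g d a)
                      (λ _ → tM.avoids-cons {e = e} g c (Equivalence.from (same e) a))
      ; (no ¬a) → let i , eq = complete (∈-allVecs e) ¬a in subst (AvoidsAlike g) eq (realized-alike g i)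
      }

-- Quantifier elimination and completeness

identity : ∀ {ℓ} (M : Structure ℓ) → Embedding M M
identity M = record
  { map        = id
  ; cong       = id
  ; injective  = id
  ; plus-homo  = λ _ _ → refl′
  ; times-homo = λ _ _ → refl′
  ; bar-homo   = λ _ → refl′
  ; zero-homo  = refl′
  ; one-homo   = refl′
  }
  where
  open IsEquivalence (Structure.isEquivalence M) renaming (refl to refl′)

module Elimination (em : ∀ {a} → ExcludedMiddle a) (ℓ : Level) where

  ECDA⇒DeMorgan : ∀ {M : Structure ℓ} → IsModel M ECDA → IsModel M DeMorgan
  ECDA⇒DeMorgan m φ = m φ ∘ complementedDeMorgan ∘ deMorgan

  rep : ∀ {M : Structure ℓ} → IsModel M ECDA → Representation M
  rep m = Splits.representation em (ECDA⇒DeMorgan m)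

  extend : ∀ {n} {M N : Structure ℓ} (m : IsModel M ECDA) (m′ : IsModel N ECDA) {ρ : Vec _ n} {ρ′} →
    SameType (rep m) (rep m′) ρ ρ′ → ∀ a → ∃ λ b → SameType (rep m) (rep m′) (a ∷ ρ) (b ∷ ρ′)
  extend m m′ same a = BackAndForth.backAndForth em (rep m) (rep m′) m′ _ _ same a

  -- The Ehrenfeucht-Fraïssé induction: equations depend on the type only, and `extend` provides the
  -- answering element at each quantifier, in either direction.
  invariant : ∀ {n} (φ : Formula n) {M N : Structure ℓ} (m : IsModel M ECDA) (m′ : IsModel N ECDA) {ρ ρ′} →
    SameType (rep m) (rep m′) ρ ρ′ → Satisfies M ρ φ ⟺ Satisfies N ρ′ φ
  invariant (s ≐ t) m m′ {ρ} {ρ′} same = mk⇔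
    (λ h → M.from λ e s≢t → Equivalence.to (same e) (M′.to h e s≢t))
    (λ h → M′.from λ e s≢t → Equivalence.from (same e) (M.to h e s≢t))
    where
    module M′ = Equivalence (Types.equation⟺ (rep m) s t ρ)
    module M = Equivalence (Types.equation⟺ (rep m′) s t ρ′)
  invariant false   m m′ same = mk⇔ (λ ()) (λ ())
  invariant (φ ∧ ψ) m m′ same = invariant φ m m′ same ×-⇔ invariant ψ m m′ same
  invariant (φ ∨ ψ) m m′ same = invariant φ m m′ same ⊎-⇔ invariant ψ m m′ same
  invariant (φ ⇒ ψ) m m′ same = →-cong-⇔ (invariant φ m m′ same) (invariant ψ m m′ same)
  invariant (all φ) m m′ same = mk⇔
    (λ h b → let a , same′ = extend m′ m (sym⟺ ∘ same) b
             in Equivalence.from (invariant φ m′ m same′) (h a))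
    (λ h a → let b , same′ = extend m m′ same a
             in Equivalence.from (invariant φ m m′ same′) (h b))
  invariant (ex φ) m m′ same = mk⇔
    (λ (a , h) → let b , same′ = extend m m′ same a
                 in b , Equivalence.to (invariant φ m m′ same′) h)
    (λ (b , h) → let a , same′ = extend m′ m (sym⟺ ∘ same) b
                 in a , Equivalence.to (invariant φ m′ m same′) h)

  Class : ℕ → Set (lsuc ℓ)
  Class n = (M : Structure ℓ) → Vec (Structure.Carrier M) n → Set ℓ

  -- Splitting C along the χs leaves classes on which φ is constant.
  interpolate : ∀ {n} (φ : Formula n) (C : Class n) {χs : List (Formula n)} → All QuantifierFree χs →
    (∀ {M N ρ ρ′} → C M ρ → C N ρ′ → All (λ χ → Satisfies M ρ χ ⟺ Satisfies N ρ′ χ) χs →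
      Satisfies M ρ φ → Satisfies N ρ′ φ) →
    ∃[ ψ ] QuantifierFree ψ × (∀ {M ρ} → C M ρ → Satisfies M ρ (φ ⇔ ψ))
  interpolate φ C [] dep with em {P = ∃[ M ] Σ[ ρ ∈ _ ] C M ρ × Satisfies M ρ φ}
  ... | yes (M , ρ , c , h) = Defs.true , (false ⇒ false) , λ c′ → (λ _ → id) , (λ _ → dep c c′ [] h)
  ... | no none             = false , false , λ c → (λ h → contradiction (-, -, c , h) none) , λ ()
  interpolate {n} φ C {χ ∷ χs} (qf-χ ∷ qf-χs) dep =
    let ψ₁ , qf₁ , eq₁ = interpolate φ C₁ qf-χs λ (c , h) (c′ , h′) hs →
          dep c c′ (mk⇔ (const h′) (const h) ∷ hs)
        ψ₂ , qf₂ , eq₂ = interpolate φ C₂ qf-χs λ (c , h) (c′ , h′) hs →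
          dep c c′ (mk⇔ (λ s → contradiction s h) (λ s → contradiction s h′) ∷ hs)
    in ((χ ∧ ψ₁) ∨ (neg χ ∧ ψ₂)) , ((qf-χ ∧ qf₁) ∨ ((qf-χ ⇒ false) ∧ qf₂)) , λ {M} {ρ} c →
      (λ h → case em {P = Satisfies M ρ χ} of λ
        { (yes s) → inj₁ (s , proj₁ (eq₁ (c , s)) h)
        ; (no ¬s) → inj₂ ((λ s → contradiction s ¬s) , proj₁ (eq₂ (c , ¬s)) h) })
      , λ { (inj₁ (s , h)) → proj₂ (eq₁ (c , s)) h
          ; (inj₂ (¬s , h)) → proj₂ (eq₂ (c , λ s → case ¬s s of λ ())) h }
    where
    C₁ C₂ : Class n
    C₁ M ρ = C M ρ × Satisfies M ρ χ
    C₂ M ρ = C M ρ × ¬ Satisfies M ρ χ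

  -- The finitely many equations `avoids e` determine the type of a tuple, and `invariant` makes `φ`
  -- depend on that type alone.
  quantifierElimination : QuantifierElimination ℓ ECDA
  quantifierElimination {n} φ =
    let ψ , q , eq = interpolate φ (λ M _ → IsModel M ECDA)
          (All.map⁺ (All.universal (λ e → _ ≐ _) (allVecs n)))
          (λ m m′ hs → Equivalence.to (invariant φ m m′ (sameType m m′ hs)))
    in ψ , q , λ M m ρ → eq m
    where
    sameType : ∀ {M N} (m : IsModel M ECDA) (m′ : IsModel N ECDA) {ρ ρ′} →
      All (λ χ → Satisfies M ρ χ ⟺ Satisfies N ρ′ χ) (List.map avoids (allVecs n)) →
      SameType (rep m) (rep m′) ρ ρ′
    sameType m m′ {ρ} {ρ′} hs e = ⟺-trans (sym⟺ (Representation.avoids⟺Avoids (rep m) e ρ))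
      (⟺-trans (All.lookup (All.map⁻ hs) (∈-allVecs e)) (Representation.avoids⟺Avoids (rep m′) e ρ′))

  -- With a single point and the trivial filter the model consists of the functions from 𝟜^ℕ to 𝟜
  -- that depend on finitely many coordinates.
  satisfiable : Satisfiable ℓ ECDA
  satisfiable = LocalFunctions.structure point , isECDA point _
    where
    point : FilterBase ℓ
    point = record
      { Point = Lift ℓ ⊤ ; Stage = Lift ℓ ⊤ ; Holds = λ _ _ → Lift ℓ ⊤
      ; ⊤ˢ = _ ; _⊓ˢ_ = _ ; ⊓ˢ-holds = _ }

  complete : Complete ℓ ECDA
  complete = satisfiable , λ φ → case em {P = ∃[ M ] IsModel M ECDA × Satisfies M [] φ} of λ
    { (yes (M , m , h)) → inj₁ λ { N m′ [] → Equivalence.to (invariant φ m m′ (sameType m m′)) h }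
    ; (no none)         → inj₂ λ { N m′ [] h → contradiction (N , m′ , h) none }
    }
    where
    -- The empty tuple has only one value, and it is not avoided since 0 ≠ 1; hence empty tuples
    -- have the same type in all models.
    realised : ∀ {M} (m : IsModel M ECDA) → ¬ Representation.Avoids (rep m) [] []
    realised m h = Types.some-unavoided (rep m) (λ 0≈1 → case ECDA⇒DeMorgan m _ zero≠one 0≈1 of λ ()) [] λ { [] → h }
    sameType : ∀ {M N} (m : IsModel M ECDA) (m′ : IsModel N ECDA) → SameType (rep m) (rep m′) [] []
    sameType m m′ [] = mk⇔ (λ h → contradiction h (realised m)) (λ h → contradiction h (realised m′))

  isModelCompletion : IsModelCompletion ℓ ECDA DeMorgan
  isModelCompletion = record
    { amalgamation     = λ M₀ M₁ M₂ m₀ m₁ m₂ f₁ f₂ →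
        let _ , m , g₁ , g₂ , commutes = amalgamate em m₀ m₁ m₂ f₁ f₂ in _ , ECDA⇒DeMorgan m , g₁ , g₂ , commutes
    ; isModelCompanion = record
      { modelComplete = λ φ → let ψ , q , eq = quantifierElimination φ in ψ , qf q , eq
      ; T-into-T′     = λ M m →
          let _ , m′ , g , _ = amalgamate em m m m (identity M) (identity M) in _ , m′ , g
      ; T′-into-T     = λ M m → M , ECDA⇒DeMorgan m , identity M
      }
    }

theorem5p2 : (∀ {a} → ExcludedMiddle a) → (ℓ : Level) →
    IsModelCompletion ℓ ECDA DeMorgan × Complete ℓ ECDA × QuantifierElimination ℓ ECDA
theorem5p2 em ℓ = isModelCompletion , complete , quantifierElimination
  where
  open Elimination em ℓ
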